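{- Let $(A,\oplus,\neg,\bar 0,\kappa)$ be a continuous algebra. Then the Chang group $G_A$ of the MV-algebra $(A,\oplus,\neg,\bar 0)$, with strong unit $u=\langle(\bar 1),(\bar 0)\rangle$, is a $2$-divisible $\ell u$-group.
   Context: A continuous algebra is a tuple $(A,\oplus,\neg,\bar 0,\kappa)$, where $\oplus$ is a binary operation on $A$, $\bar 0\in A$, and $\neg,\kappa$ are unary operations on $A$, such that for all $x,y,z\in A$: (C1) $x\oplus(y\oplus z)=(x\oplus y)\oplus z$; (C2) $x\oplus y=y\oplus x$; (C3) $x\oplus\bar 0=x$; (C4) $\neg\neg x=x$; (C5) $x\oplus\neg\bar 0=\neg\bar 0$; (C6) $\neg(\neg x\oplus y)\oplus y=\neg(\neg y\oplus x)\oplus x$; (C7) $\kappa x=x\oplus\neg\kappa x$; (C8) $(\neg\kappa x\oplus\kappa y)\oplus\neg(\neg x\oplus y)=\neg\bar 0$. (C1)-(C6) say that $(A,\oplus,\neg,\bar 0)$ is an MV-algebra. Write $\bar 1=\neg\bar 0$, $x\odot y=\neg(\neg x\oplus\neg y)$, and $x\le y$ iff $\neg x\oplus y=\bar 1$. An $\ell u$-group is a tuple $(G,+,-,id,\vee,\wedge,u)$ where $(G,+,-,id)$ is an abelian group, $(G,\vee,\wedge)$ is a lattice, $(x\vee y)+z=(x+z)\vee(y+z)$ for all $x,y,z\in G$, and $u$ is a strong unit: for all $x\in G$ there is a natural number $n$ with $|x|\le nu$ (where $|x|=x\vee -x$). It is $2$-divisible if for each $g\in G$ there is $h\in G$ with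 $g=h+h$. Chang group (standard): a good sequence in $A$ is a sequence $\mathbf a=(a_1,a_2,\dots)$ of elements of $A$ with $a_i\oplus a_{i+1}=a_i$ for all $i$ and $a_i=\bar 0$ for all large $i$; $(a)$ denotes $(a,\bar 0,\bar 0,\dots)$. The sum $\mathbf c=\mathbf a+\mathbf b$ is $c_i=a_i\oplus(a_{i-1}\odot b_1)\oplus\cdots\oplus(a_1\odot b_{i-1})\oplus b_i$; good sequences form a cancellative abelian monoid $M_A$ with identity $(\bar 0)$, ordered componentwise. $G_A$ is the group of equivalence classes $\langle\mathbf a,\mathbf b\rangle$ of pairs of good sequences, with $(\mathbf a,\mathbf b)\sim(\mathbf c,\mathbf d)$ iff $\mathbf a+\mathbf d=\mathbf c+\mathbf b$, with componentwise addition, and ordered by $\langle\mathbf a,\mathbf b\rangle\preceq\langle\mathbf c,\mathbf d\rangle$ iff $\mathbf a+\mathbf d\le\mathbf c+\mathbf b$; this is an $\ell u$-group with strong unit $\langle(\bar 1),(\bar 0)\rangle$. -}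

module Defs where

open import Algebra.Bundles using (RawMonoid)
open import Algebra.Core using (Op₁; Op₂)
open import Algebra.Definitions using (Associative; Commutative; RightIdentity; RightZero; Involutive; Congruent₁; Congruent₂; _DistributesOverʳ_)
open import Algebra.Structures using (IsAbelianGroup)
open import Algebra.Lattice.Structures using (IsLattice)
import Algebra.Definitions.RawMonoid as Multiples
open import Data.Nat.Base as ℕ using (ℕ; zero; suc; _∸_; s≤s)
import Data.Nat.Properties as ℕₚ
open import Data.Product.Base using (∃; _×_; _,_)
open import Data.Sum.Base using (inj₁; inj₂)
open import Level using (_⊔_) renaming (suc to lsuc)
open import Relation.Binary.Bundles using (Setoid; Poset)
open import Relation.Binary.Core using (Rel)
open import Relation.Binary.Structures using (IsEquivalence)
import Relation.Binary.PropositionalEquality.Core as ≡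
import Relation.Binary.Reasoning.Setoid as SetoidReasoning
import Relation.Binary.Reasoning.PartialOrder as PosetReasoning

record IsMVAlgebra {c ℓ} {A : Set c} (_≈_ : Rel A ℓ)
                   (_⊕_ : Op₂ A) (¬_ : Op₁ A) (0̄ : A) : Set (c ⊔ ℓ) where
  field
    isEquivalence : IsEquivalence _≈_
    ⊕-cong        : Congruent₂ _≈_ _⊕_
    ¬-cong        : Congruent₁ _≈_ ¬_
    ⊕-assoc       : Associative _≈_ _⊕_
    ⊕-comm        : Commutative _≈_ _⊕_
    ⊕-identityʳ   : RightIdentity _≈_ 0̄ _⊕_
    ¬-involutive  : Involutive _≈_ ¬_
    ⊕-zeroʳ       : RightZero _≈_ (¬ 0̄) _⊕_
    łukasiewicz   : ∀ x y → ((¬ ((¬ x) ⊕ y)) ⊕ y) ≈ ((¬ ((¬ y) ⊕ x)) ⊕ x)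

record MVAlgebra c ℓ : Set (lsuc (c ⊔ ℓ)) where
  infix  8 ¬_
  infixl 6 _⊕_
  infix  4 _≈_
  field
    Carrier     : Set c
    _≈_         : Rel Carrier ℓ
    _⊕_         : Op₂ Carrier
    ¬_          : Op₁ Carrier
    0̄           : Carrier
    isMVAlgebra : IsMVAlgebra _≈_ _⊕_ ¬_ 0̄

  open IsMVAlgebra isMVAlgebra public

  infixl 7 _⊙_
  infix  4 _≤_

  1̄ : Carrier
  1̄ = ¬ 0̄

  _⊙_ : Op₂ Carrier
  x ⊙ y = ¬ (¬ x ⊕ ¬ y)

  _≤_ : Rel Carrier ℓ
  x ≤ y = ¬ x ⊕ y ≈ 1̄

record IsContinuousAlgebra {c ℓ} {A : Set c} (_≈_ : Rel A ℓ)
                           (_⊕_ : Op₂ A) (¬_ : Op₁ A) (0̄ : A) (κ : Op₁ A) : Set (c ⊔ ℓ) where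
  field
    isMVAlgebra : IsMVAlgebra _≈_ _⊕_ ¬_ 0̄
    κ-cong      : Congruent₁ _≈_ κ
    κ-fix       : ∀ x → κ x ≈ (x ⊕ (¬ κ x))
    κ-lip       : ∀ x y → (((¬ κ x) ⊕ κ y) ⊕ (¬ ((¬ x) ⊕ y))) ≈ (¬ 0̄)

record ContinuousAlgebra c ℓ : Set (lsuc (c ⊔ ℓ)) where
  field
    Carrier             : Set c
    _≈_                 : Rel Carrier ℓ
    _⊕_                 : Op₂ Carrier
    ¬_                  : Op₁ Carrier
    0̄                   : Carrier
    κ                   : Op₁ Carrier
    isContinuousAlgebra : IsContinuousAlgebra _≈_ _⊕_ ¬_ 0̄ κ

  open IsContinuousAlgebra isContinuousAlgebra public

  mvAlgebra : MVAlgebra c ℓ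
  mvAlgebra = record { isMVAlgebra = isMVAlgebra }

record IsℓuGroup {c ℓ} {G : Set c} (_≈_ : Rel G ℓ)
                 (_+_ : Op₂ G) (-_ : Op₁ G) (id : G)
                 (_∨_ _∧_ : Op₂ G) (u : G) : Set (c ⊔ ℓ) where
  _≤_ : Rel G ℓ
  x ≤ y = (x ∧ y) ≈ x

  ∣_∣ : Op₁ G
  ∣ x ∣ = x ∨ (- x)

  rawMonoid : RawMonoid c ℓ
  rawMonoid = record { Carrier = G ; _≈_ = _≈_ ; _∙_ = _+_ ; ε = id }

  open Multiples rawMonoid using () renaming (_×_ to _·_)

  field
    isAbelianGroup : IsAbelianGroup _≈_ _+_ id -_
    isLattice      : IsLattice _≈_ _∨_ _∧_
    +-distribʳ-∨   : _DistributesOverʳ_ _≈_ _+_ _∨_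
    strongUnit     : ∀ x → ∃ λ n → ∣ x ∣ ≤ (n · u)

TwoDivisible : ∀ {c ℓ} {G : Set c} → Rel G ℓ → Op₂ G → Set (c ⊔ ℓ)
TwoDivisible _≈_ _+_ = ∀ g → ∃ λ h → g ≈ (h + h)

-- cross-absorb is what makes good sequences closed under addition.
module MVProperties {c ℓ} (A : MVAlgebra c ℓ) where
  open MVAlgebra A
  open IsEquivalence isEquivalence using (refl; sym; trans)

  setoid : Setoid c ℓ
  setoid = record { isEquivalence = isEquivalence }

  module ≈R = SetoidReasoning setoid

  ⊕-congˡ : ∀ {x y z} → y ≈ z → x ⊕ y ≈ x ⊕ z
  ⊕-congˡ = ⊕-cong refl

  ⊕-congʳ : ∀ {x y z} → y ≈ z → y ⊕ x ≈ z ⊕ x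
  ⊕-congʳ e = ⊕-cong e refl

  ⊕-identityˡ : ∀ x → 0̄ ⊕ x ≈ x
  ⊕-identityˡ x = trans (⊕-comm 0̄ x) (⊕-identityʳ x)

  ¬1≈0 : ¬ 1̄ ≈ 0̄
  ¬1≈0 = ¬-involutive 0̄

  ¬x⊕x≈1 : ∀ x → ¬ x ⊕ x ≈ 1̄
  ¬x⊕x≈1 x = begin
    ¬ x ⊕ x              ≈⟨ ⊕-congʳ (¬-cong (⊕-identityˡ x)) ⟨
    ¬ (0̄ ⊕ x) ⊕ x        ≈⟨ ⊕-congʳ (¬-cong (⊕-congʳ ¬1≈0)) ⟨
    ¬ (¬ 1̄ ⊕ x) ⊕ x      ≈⟨ łukasiewicz x 1̄ ⟨
    ¬ (¬ x ⊕ 1̄) ⊕ 1̄      ≈⟨ ⊕-zeroʳ _ ⟩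
    1̄                    ∎
    where open ≈R

  ≤-reflexive : ∀ {x y} → x ≈ y → x ≤ y
  ≤-reflexive e = trans (⊕-congˡ (sym e)) (¬x⊕x≈1 _)

  join-≤ : ∀ {x y} → x ≤ y → ¬ (¬ x ⊕ y) ⊕ y ≈ y
  join-≤ {x} {y} p = trans (⊕-congʳ (trans (¬-cong p) ¬1≈0)) (⊕-identityˡ y)

  ≤-antisym : ∀ {x y} → x ≤ y → y ≤ x → x ≈ y
  ≤-antisym {x} {y} p q = begin
    x                    ≈⟨ join-≤ q ⟨
    ¬ (¬ y ⊕ x) ⊕ x      ≈⟨ łukasiewicz x y ⟨
    ¬ (¬ x ⊕ y) ⊕ y      ≈⟨ join-≤ p ⟩
    y                    ∎
    where open ≈R

  y≤x⊕y : ∀ x y → y ≤ x ⊕ y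
  y≤x⊕y x y = begin
    ¬ y ⊕ (x ⊕ y)   ≈⟨ ⊕-comm _ _ ⟩
    (x ⊕ y) ⊕ ¬ y   ≈⟨ ⊕-assoc x y (¬ y) ⟩
    x ⊕ (y ⊕ ¬ y)   ≈⟨ ⊕-congˡ (trans (⊕-comm _ _) (¬x⊕x≈1 y)) ⟩
    x ⊕ 1̄           ≈⟨ ⊕-zeroʳ x ⟩
    1̄               ∎
    where open ≈R

  ≤-respʳ : ∀ {x y z} → y ≈ z → x ≤ y → x ≤ z
  ≤-respʳ e p = trans (⊕-congˡ (sym e)) p

  ≤⇒diff : ∀ {x y} → x ≤ y → y ≈ ¬ (¬ y ⊕ x) ⊕ x
  ≤⇒diff {x} {y} p = trans (sym (join-≤ p)) (łukasiewicz x y)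

  ≤-trans : ∀ {x y z} → x ≤ y → y ≤ z → x ≤ z
  ≤-trans {x} {y} {z} p q = ≤-respʳ (sym e) (y≤x⊕y _ x)
    where
    e : z ≈ (¬ (¬ z ⊕ y) ⊕ ¬ (¬ y ⊕ x)) ⊕ x
    e = trans (≤⇒diff q) (trans (⊕-congˡ (≤⇒diff p)) (sym (⊕-assoc _ _ _)))

  poset : Poset c ℓ ℓ
  poset = record
    { _≤_ = _≤_
    ; isPartialOrder = record
      { isPreorder = record
        { isEquivalence = isEquivalence ; reflexive = ≤-reflexive ; trans = ≤-trans }
      ; antisym = ≤-antisym } }

  module ≤R = PosetReasoning poset

  ⊕-monoˡ : ∀ z {x y} → x ≤ y → z ⊕ x ≤ z ⊕ y
  ⊕-monoˡ z {x} {y} p = ≤-respʳ (sym e) (y≤x⊕y _ (z ⊕ x))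
    where
    d = ¬ (¬ y ⊕ x)
    open ≈R
    e : z ⊕ y ≈ d ⊕ (z ⊕ x)
    e = begin
      z ⊕ y         ≈⟨ ⊕-congˡ (≤⇒diff p) ⟩
      z ⊕ (d ⊕ x)   ≈⟨ ⊕-assoc z d x ⟨
      (z ⊕ d) ⊕ x   ≈⟨ ⊕-congʳ (⊕-comm z d) ⟩
      (d ⊕ z) ⊕ x   ≈⟨ ⊕-assoc d z x ⟩
      d ⊕ (z ⊕ x)   ∎

  ⊕-mono : ∀ {x y z w} → x ≤ y → z ≤ w → x ⊕ z ≤ y ⊕ w
  ⊕-mono {x} {y} {z} {w} p q = begin
    x ⊕ z   ≤⟨ ⊕-monoˡ x q ⟩
    x ⊕ w   ≈⟨ ⊕-comm x w ⟩
    w ⊕ x   ≤⟨ ⊕-monoˡ w p ⟩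
    w ⊕ y   ≈⟨ ⊕-comm w y ⟩
    y ⊕ w   ∎
    where open ≤R

  ¬-anti : ∀ {x y} → x ≤ y → ¬ y ≤ ¬ x
  ¬-anti {x} {y} p = trans (⊕-congʳ (¬-involutive y)) (trans (⊕-comm y (¬ x)) p)

  ⊙-mono : ∀ {x y z w} → x ≤ y → z ≤ w → x ⊙ z ≤ y ⊙ w
  ⊙-mono p q = ¬-anti (⊕-mono (¬-anti p) (¬-anti q))

  ⊙-monoˡ : ∀ z {x y} → x ≤ y → z ⊙ x ≤ z ⊙ y
  ⊙-monoˡ z = ⊙-mono (≤-reflexive refl)

  ⊙-monoʳ : ∀ z {x y} → x ≤ y → x ⊙ z ≤ y ⊙ z
  ⊙-monoʳ z p = ⊙-mono p (≤-reflexive refl)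

  ⊙-cong : ∀ {x y z w} → x ≈ y → z ≈ w → x ⊙ z ≈ y ⊙ w
  ⊙-cong p q = ¬-cong (⊕-cong (¬-cong p) (¬-cong q))

  ⊙-comm : ∀ x y → x ⊙ y ≈ y ⊙ x
  ⊙-comm x y = ¬-cong (⊕-comm _ _)

  ⊙-assoc : ∀ x y z → (x ⊙ y) ⊙ z ≈ x ⊙ (y ⊙ z)
  ⊙-assoc x y z = ¬-cong (begin
    ¬ ¬ (¬ x ⊕ ¬ y) ⊕ ¬ z      ≈⟨ ⊕-congʳ (¬-involutive _) ⟩
    (¬ x ⊕ ¬ y) ⊕ ¬ z          ≈⟨ ⊕-assoc _ _ _ ⟩
    ¬ x ⊕ (¬ y ⊕ ¬ z)          ≈⟨ ⊕-congˡ (¬-involutive _) ⟨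
    ¬ x ⊕ ¬ ¬ (¬ y ⊕ ¬ z)      ∎)
    where open ≈R

  ⊙-identityʳ : ∀ x → x ⊙ 1̄ ≈ x
  ⊙-identityʳ x = trans (¬-cong (trans (⊕-congˡ ¬1≈0) (⊕-identityʳ _))) (¬-involutive x)

  ⊙-identityˡ : ∀ x → 1̄ ⊙ x ≈ x
  ⊙-identityˡ x = trans (⊙-comm _ _) (⊙-identityʳ x)

  ⊙-zeroʳ : ∀ x → x ⊙ 0̄ ≈ 0̄
  ⊙-zeroʳ x = trans (¬-cong (⊕-zeroʳ _)) ¬1≈0

  ⊙-zeroˡ : ∀ x → 0̄ ⊙ x ≈ 0̄
  ⊙-zeroˡ x = trans (⊙-comm _ _) (⊙-zeroʳ x)

  0≤x : ∀ x → 0̄ ≤ x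
  0≤x x = trans (⊕-comm _ _) (⊕-zeroʳ x)

  x⊙y≤x : ∀ x y → x ⊙ y ≤ x
  x⊙y≤x x y = ≤-respʳ (¬-involutive x)
    (¬-anti (≤-respʳ (⊕-comm _ _) (y≤x⊕y (¬ y) (¬ x))))

  residual-to : ∀ {x y z} → x ⊙ y ≤ z → x ≤ ¬ y ⊕ z
  residual-to p = trans (sym (trans (⊕-congʳ (¬-involutive _)) (⊕-assoc _ _ _))) p

  residual-from : ∀ {x y z} → x ≤ ¬ y ⊕ z → x ⊙ y ≤ z
  residual-from p = trans (trans (⊕-congʳ (¬-involutive _)) (⊕-assoc _ _ _)) p

  modus-ponens : ∀ x y → x ⊙ (¬ x ⊕ y) ≤ y
  modus-ponens x y = ≤-trans (≤-reflexive (⊙-comm _ _)) (residual-from (≤-reflexive refl))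

  modus-ponens′ : ∀ x y → ¬ x ⊙ (x ⊕ y) ≤ y
  modus-ponens′ x y = ≤-trans
    (⊙-monoˡ (¬ x) (≤-reflexive (⊕-congʳ (sym (¬-involutive x)))))
    (modus-ponens (¬ x) y)

  ¬x⊙x≤0 : ∀ x → ¬ x ⊙ x ≤ 0̄
  ¬x⊙x≤0 x = ≤-reflexive (trans (¬-cong (¬x⊕x≈1 (¬ x))) ¬1≈0)

  meet-comm : ∀ x y → x ⊙ (¬ x ⊕ y) ≈ y ⊙ (¬ y ⊕ x)
  meet-comm x y = begin
    ¬ (¬ x ⊕ ¬ (¬ x ⊕ y))           ≈⟨ ¬-cong (⊕-comm _ _) ⟩
    ¬ (¬ (¬ x ⊕ y) ⊕ ¬ x)           ≈⟨ ¬-cong (⊕-congʳ (¬-cong (flip x y))) ⟩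
    ¬ (¬ (¬ ¬ y ⊕ ¬ x) ⊕ ¬ x)       ≈⟨ ¬-cong (łukasiewicz (¬ y) (¬ x)) ⟩
    ¬ (¬ (¬ ¬ x ⊕ ¬ y) ⊕ ¬ y)       ≈⟨ ¬-cong (⊕-congʳ (¬-cong (flip y x))) ⟨
    ¬ (¬ (¬ y ⊕ x) ⊕ ¬ y)           ≈⟨ ¬-cong (⊕-comm _ _) ⟩
    ¬ (¬ y ⊕ ¬ (¬ y ⊕ x))           ∎
    where
    open ≈R
    flip : ∀ x y → ¬ x ⊕ y ≈ ¬ ¬ y ⊕ ¬ x
    flip x y = trans (⊕-comm _ _) (⊕-congʳ (sym (¬-involutive y)))

  ⊙-⊕-shift : ∀ p b q → p ⊙ (b ⊕ q) ≤ (p ⊙ b) ⊕ q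
  ⊙-⊕-shift p b q = ≤-trans (residual-to′ step) (≤-reflexive (⊕-comm _ _))
    where
    open ≤R
    residual-to′ : ∀ {x y z} → x ⊙ ¬ y ≤ z → x ≤ y ⊕ z
    residual-to′ r = ≤-respʳ (⊕-congʳ (¬-involutive _)) (residual-to r)
    step : p ⊙ (b ⊕ q) ⊙ ¬ q ≤ p ⊙ b
    step = begin
      p ⊙ (b ⊕ q) ⊙ ¬ q     ≈⟨ ⊙-assoc _ _ _ ⟩
      p ⊙ ((b ⊕ q) ⊙ ¬ q)   ≈⟨ ⊙-cong refl (⊙-cong (⊕-comm b q) refl) ⟩
      p ⊙ ((q ⊕ b) ⊙ ¬ q)   ≈⟨ ⊙-cong refl (⊙-comm _ _) ⟩
      p ⊙ (¬ q ⊙ (q ⊕ b))   ≤⟨ ⊙-monoˡ p (modus-ponens′ q b) ⟩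
      p ⊙ b                 ∎

  absorb-to : ∀ {x t} → x ⊕ t ≈ x → t ≤ x ⊙ t
  absorb-to {x} {t} e = begin
    ¬ t ⊕ x ⊙ t              ≈⟨ ⊕-comm _ _ ⟩
    x ⊙ t ⊕ ¬ t              ≈⟨ łukasiewicz x (¬ t) ⟩
    ¬ (¬ ¬ t ⊕ x) ⊕ x        ≈⟨ ⊕-congʳ (¬-cong (trans (⊕-congʳ (¬-involutive t)) (trans (⊕-comm t x) e))) ⟩
    ¬ x ⊕ x                  ≈⟨ ¬x⊕x≈1 x ⟩
    1̄                        ∎
    where open ≈R

  absorb-from : ∀ {x t} → t ≤ x ⊙ t → x ⊕ t ≈ x
  absorb-from {x} {t} p = trans (⊕-comm x t) (≤-antisym le (y≤x⊕y t x))
    where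
    open ≈R
    le : t ⊕ x ≤ x
    le = begin
      ¬ (t ⊕ x) ⊕ x            ≈⟨ ⊕-congʳ (¬-cong (⊕-congʳ (¬-involutive t))) ⟨
      ¬ (¬ ¬ t ⊕ x) ⊕ x        ≈⟨ łukasiewicz x (¬ t) ⟨
      x ⊙ t ⊕ ¬ t              ≈⟨ ⊕-comm _ _ ⟩
      ¬ t ⊕ x ⊙ t              ≈⟨ p ⟩
      1̄                        ∎

  absorb-mono : ∀ {x y t} → x ≤ y → x ⊕ t ≈ x → y ⊕ t ≈ y
  absorb-mono {t = t} p e = absorb-from (≤-trans (absorb-to e) (⊙-monoʳ t p))

  ⊕-absorbs-⊙ : ∀ q s → q ⊙ s ≤ (q ⊕ s) ⊙ (q ⊙ s)
  ⊕-absorbs-⊙ q s = ≤-trans claim (≤-reflexive (⊙-comm _ _))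
    where
    t = q ⊙ s
    n = ¬ (q ⊕ s)
    w = ¬ s ⊕ n
    n≈ : n ≈ ¬ s ⊙ ¬ q
    n≈ = ¬-cong (trans (⊕-comm q s) (⊕-cong (sym (¬-involutive s)) (sym (¬-involutive q))))
    ¬w≤s : ¬ w ≤ s
    ¬w≤s = ≤-respʳ (¬-involutive s) (¬-anti (≤-respʳ (⊕-comm n (¬ s)) (y≤x⊕y n (¬ s))))
    disjoint : t ⊙ (¬ t ⊕ n) ≤ 0̄
    disjoint = begin
      t ⊙ (¬ t ⊕ n)                   ≈⟨ ⊙-cong (⊙-comm q s) (trans (⊕-congʳ (¬-involutive _)) (⊕-assoc _ _ _)) ⟩
      (s ⊙ q) ⊙ (¬ q ⊕ w)             ≈⟨ ⊙-assoc _ _ _ ⟩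
      s ⊙ (q ⊙ (¬ q ⊕ w))             ≈⟨ ⊙-cong refl (meet-comm q w) ⟩
      s ⊙ (w ⊙ (¬ w ⊕ q))             ≈⟨ ⊙-assoc _ _ _ ⟨
      (s ⊙ w) ⊙ (¬ w ⊕ q)             ≤⟨ ⊙-monoʳ _ (modus-ponens s n) ⟩
      n ⊙ (¬ w ⊕ q)                   ≈⟨ ⊙-cong n≈ (⊕-comm _ _) ⟩
      (¬ s ⊙ ¬ q) ⊙ (q ⊕ ¬ w)         ≈⟨ ⊙-assoc _ _ _ ⟩
      ¬ s ⊙ (¬ q ⊙ (q ⊕ ¬ w))         ≤⟨ ⊙-monoˡ _ (modus-ponens′ q (¬ w)) ⟩
      ¬ s ⊙ ¬ w                       ≤⟨ ⊙-monoˡ _ ¬w≤s ⟩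
      ¬ s ⊙ s                         ≤⟨ ¬x⊙x≤0 s ⟩
      0̄                               ∎
      where open ≤R
    claim : t ≤ t ⊙ (q ⊕ s)
    claim = begin
      ¬ t ⊕ t ⊙ (q ⊕ s)               ≈⟨ ¬-involutive _ ⟨
      ¬ ¬ (¬ t ⊕ t ⊙ (q ⊕ s))         ≈⟨ ¬-cong (¬-cong (⊕-congˡ (¬-cong refl))) ⟩
      ¬ ¬ (¬ t ⊕ ¬ (¬ t ⊕ n))         ≈⟨ ¬-cong (≤-antisym disjoint (0≤x _)) ⟩
      1̄                               ∎
      where open ≈R

  -- In a totally ordered A the hypotheses force (p = 1̄ or q = 0̄) and
  -- (r = 1̄ or s = 0̄).
  cross-absorb : ∀ {p q r s} → p ⊕ q ≈ p → r ⊕ s ≈ r →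
                 (p ⊙ s ⊕ q ⊙ r) ⊕ q ⊙ s ≈ p ⊙ s ⊕ q ⊙ r
  cross-absorb {p} {q} {r} {s} gp gr = absorb-from (begin
    q ⊙ s                             ≤⟨ ⊕-absorbs-⊙ q s ⟩
    (q ⊕ s) ⊙ (q ⊙ s)                 ≤⟨ ⊙-monoˡ _ (⊙-mono (absorb-to gp) (absorb-to gr)) ⟩
    (q ⊕ s) ⊙ ((p ⊙ q) ⊙ (r ⊙ s))     ≈⟨ ⊙-cong refl shuffle ⟩
    (q ⊕ s) ⊙ ((p ⊙ r) ⊙ (q ⊙ s))     ≈⟨ ⊙-assoc _ _ _ ⟨
    ((q ⊕ s) ⊙ (p ⊙ r)) ⊙ (q ⊙ s)     ≤⟨ ⊙-monoʳ _ bound ⟩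
    (p ⊙ s ⊕ q ⊙ r) ⊙ (q ⊙ s)         ∎)
    where
    open ≤R
    shuffle : (p ⊙ q) ⊙ (r ⊙ s) ≈ (p ⊙ r) ⊙ (q ⊙ s)
    shuffle = trans (⊙-assoc _ _ _) (trans (⊙-cong refl
      (trans (sym (⊙-assoc _ _ _)) (trans (⊙-cong (⊙-comm q r) refl) (⊙-assoc _ _ _))))
      (sym (⊙-assoc _ _ _)))
    bound : (q ⊕ s) ⊙ (p ⊙ r) ≤ p ⊙ s ⊕ q ⊙ r
    bound = begin
      (q ⊕ s) ⊙ (p ⊙ r)     ≈⟨ ⊙-comm _ _ ⟩
      (p ⊙ r) ⊙ (q ⊕ s)     ≈⟨ ⊙-assoc _ _ _ ⟩
      p ⊙ (r ⊙ (q ⊕ s))     ≤⟨ ⊙-monoˡ p (⊙-⊕-shift r q s) ⟩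
      p ⊙ (r ⊙ q ⊕ s)       ≈⟨ ⊙-cong refl (trans (⊕-comm _ _) (⊕-congˡ (⊙-comm r q))) ⟩
      p ⊙ (s ⊕ q ⊙ r)       ≤⟨ ⊙-⊕-shift p s (q ⊙ r) ⟩
      p ⊙ s ⊕ q ⊙ r         ∎

module ChangGroup {c ℓ} (A : MVAlgebra c ℓ) where
  open MVAlgebra A
  private
    module P = MVProperties A
    module E = IsEquivalence isEquivalence

  -- Sequences are indexed from 0: the entry a i is the i+1-st term of the
  -- sequence (a₁, a₂, …).
  Seq : Set c
  Seq = ℕ → Carrier

  IsGood : Seq → Set ℓ
  IsGood a = ∀ i → a i ⊕ a (suc i) ≈ a i

  EventuallyZero : Seq → Set ℓ
  EventuallyZero a = ∃ λ N → ∀ i → N ℕ.≤ i → a i ≈ 0̄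

  record GoodSequence : Set (c ⊔ ℓ) where
    field
      seq            : Seq
      isGood         : IsGood seq
      eventuallyZero : EventuallyZero seq

  open GoodSequence public

  ⨁ : ℕ → Seq → Carrier
  ⨁ zero      f = 0̄
  ⨁ (suc n) f = ⨁ n f ⊕ f n

  infixl 6 _+ˢ_
  _+ˢ_ : Seq → Seq → Seq
  (a +ˢ b) i = a i ⊕ ⨁ i (λ j → a (i ∸ suc j) ⊙ b j) ⊕ b i

  module _ where
    private
      -- a shifted by one, with the convention a₀ = 1̄
      _⁺ : Seq → Seq
      (a ⁺) zero      = 1̄
      (a ⁺) (suc i) = a i

      ⁺-good : ∀ {a} → IsGood a → ∀ i → (a ⁺) i ⊕ a i ≈ (a ⁺) i
      ⁺-good g zero      = E.trans (⊕-comm _ _) (⊕-zeroʳ _)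
      ⁺-good g (suc i) = g i

      ⨁-cong : ∀ n {f g} → (∀ j → j ℕ.< n → f j ≈ g j) → ⨁ n f ≈ ⨁ n g
      ⨁-cong zero      e = E.refl
      ⨁-cong (suc n) e = ⊕-cong (⨁-cong n (λ j l → e j (ℕₚ.m≤n⇒m≤1+n l))) (e n ℕₚ.≤-refl)

      ⨁-zero : ∀ n {f} → (∀ j → j ℕ.< n → f j ≈ 0̄) → ⨁ n f ≈ 0̄
      ⨁-zero zero      e = E.refl
      ⨁-zero (suc n) e = E.trans
        (⊕-cong (⨁-zero n (λ j l → e j (ℕₚ.m≤n⇒m≤1+n l))) (e n ℕₚ.≤-refl)) (⊕-identityʳ 0̄)

      ⨁-shift : ∀ n f → ⨁ (suc n) f ≈ f 0 ⊕ ⨁ n (λ j → f (suc j))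
      ⨁-shift zero      f = ⊕-comm _ _
      ⨁-shift (suc n) f = E.trans (P.⊕-congʳ (⨁-shift n f)) (⊕-assoc _ _ _)

      ⨁-two : ∀ n f j → suc j ℕ.< n → f (suc j) ⊕ f j ≤ ⨁ n f
      ⨁-two (suc n) f j (s≤s l) with ℕₚ.m≤n⇒m<n∨m≡n l
      ... | inj₁ l′ = P.≤-trans (⨁-two n f j l′) (P.≤-respʳ (⊕-comm _ _) (P.y≤x⊕y _ _))
      ... | inj₂ ≡.refl = P.≤-trans (P.≤-reflexive (⊕-comm _ _))
        (P.⊕-mono (P.y≤x⊕y _ _) (P.≤-reflexive E.refl))

      ⨁-absorb : ∀ {x} n f → (∀ j → j ℕ.< n → x ⊕ f j ≈ x) → x ⊕ ⨁ n f ≈ x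
      ⨁-absorb zero      f e = ⊕-identityʳ _
      ⨁-absorb (suc n) f e = E.trans (E.sym (⊕-assoc _ _ _)) (E.trans
        (P.⊕-congʳ (⨁-absorb n f (λ j l → e j (ℕₚ.m≤n⇒m≤1+n l)))) (e n ℕₚ.≤-refl))

      uniform : ∀ a b i → (a +ˢ b) i ≈ ⨁ (suc (suc i)) (λ j → (a ⁺) (suc i ∸ j) ⊙ (b ⁺) j)
      uniform a b i = E.sym (E.trans (⊕-cong (⨁-shift i f) last)
                                     (P.⊕-congʳ (⊕-cong (P.⊙-identityʳ (a i)) (⨁-cong i middle))))
        where
        f : Seq
        f j = (a ⁺) (suc i ∸ j) ⊙ (b ⁺) j
        last : f (suc i) ≈ b i
        last rewrite ℕₚ.n∸n≡0 i = P.⊙-identityˡ (b i)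
        middle : ∀ j → j ℕ.< i → f (suc j) ≈ a (i ∸ suc j) ⊙ b j
        middle j j<i rewrite ≡.sym (ℕₚ.suc-pred (i ∸ j) ⦃ ℕ.>-nonZero (ℕₚ.m<n⇒0<n∸m j<i) ⦄)
                           | ℕₚ.pred[m∸n]≡m∸[1+n] i j = E.refl

    +ˢ-good : ∀ {a b} → IsGood a → IsGood b → IsGood (a +ˢ b)
    +ˢ-good {a} {b} ga gb i =
      E.trans (E.sym (⊕-assoc _ _ _))
        (E.trans (P.⊕-congʳ (E.trans (E.sym (⊕-assoc _ _ _))
          (E.trans (P.⊕-congʳ absorb-a) (⨁-absorb (suc i) _ absorb-mid)))) absorb-b)
      where
      s = (a +ˢ b) i
      absorb-a : s ⊕ a (suc i) ≈ s
      absorb-a = P.absorb-mono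
        (P.≤-respʳ (E.trans (⊕-comm _ _) (E.sym (⊕-assoc _ _ _))) (P.y≤x⊕y _ (a i))) (ga i)
      absorb-b : s ⊕ b (suc i) ≈ s
      absorb-b = P.absorb-mono (P.y≤x⊕y _ (b i)) (gb i)
      absorb-mid : ∀ j → j ℕ.< suc i → s ⊕ a (i ∸ j) ⊙ b j ≈ s
      absorb-mid j (s≤s j≤i) = P.absorb-mono bound
        (P.cross-absorb (⁺-good ga (i ∸ j)) (⁺-good gb j))
        where
        f : Seq
        f k = (a ⁺) (suc i ∸ k) ⊙ (b ⁺) k
        fj : f j ≈ a (i ∸ j) ⊙ (b ⁺) j
        fj rewrite ℕₚ.+-∸-assoc 1 j≤i = E.refl
        bound : (a ⁺) (i ∸ j) ⊙ b j ⊕ a (i ∸ j) ⊙ (b ⁺) j ≤ s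
        bound = P.≤-trans (P.≤-reflexive (P.⊕-congˡ (E.sym fj)))
          (P.≤-respʳ (E.sym (uniform a b i)) (⨁-two (suc (suc i)) f j (s≤s (s≤s j≤i))))

    +ˢ-eventuallyZero : ∀ {a b} → EventuallyZero a → EventuallyZero b → EventuallyZero (a +ˢ b)
    +ˢ-eventuallyZero {a} {b} (M , a0) (N , b0) = M ℕ.+ N , λ i l →
      E.trans (⊕-cong (⊕-cong (a0 i (ℕₚ.≤-trans (ℕₚ.m≤m+n M N) l)) (⨁-zero i (term i l)))
                      (b0 i (ℕₚ.≤-trans (ℕₚ.m≤n+m N M) l)))
              (E.trans (⊕-identityʳ _) (⊕-identityʳ 0̄))
      where
      term : ∀ i → M ℕ.+ N ℕ.≤ i → ∀ j → j ℕ.< i → a (i ∸ suc j) ⊙ b j ≈ 0̄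
      term i l j _ with ℕₚ.≤-<-connex N j
      ... | inj₁ N≤j = E.trans (P.⊙-cong E.refl (b0 j N≤j)) (P.⊙-zeroʳ _)
      ... | inj₂ j<N = E.trans (P.⊙-cong (a0 _ M≤) E.refl) (P.⊙-zeroˡ _)
        where
        M≤ : M ℕ.≤ i ∸ suc j
        M≤ = ℕₚ.≤-trans (ℕₚ.≤-reflexive (≡.sym (ℕₚ.m+n∸n≡m M N))) (ℕₚ.∸-mono l j<N)

  infixl 6 _+ᴹ_
  infix  4 _≈ᴹ_ _≤ᴹ_

  _+ᴹ_ : Op₂ GoodSequence
  a +ᴹ b = record
    { seq            = seq a +ˢ seq b
    ; isGood         = +ˢ-good (isGood a) (isGood b)
    ; eventuallyZero = +ˢ-eventuallyZero (eventuallyZero a) (eventuallyZero b)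
    }

  _≈ᴹ_ : Rel GoodSequence ℓ
  a ≈ᴹ b = ∀ i → seq a i ≈ seq b i

  _≤ᴹ_ : Rel GoodSequence ℓ
  a ≤ᴹ b = ∀ i → seq a i ≤ seq b i

  ⟦_⟧ : Carrier → GoodSequence
  ⟦ x ⟧ = record
    { seq            = λ { zero → x ; (suc _) → 0̄ }
    ; isGood         = λ { zero → ⊕-identityʳ x ; (suc _) → ⊕-identityʳ 0̄ }
    ; eventuallyZero = 1 , λ { (suc _) _ → E.refl }
    }

  -- The quotient by ∼ is rendered as a setoid: a pair (a , b) stands for
  -- the class ⟨ a , b ⟩ and _∼_ is equality in the Chang group.
  G : Set (c ⊔ ℓ)
  G = GoodSequence × GoodSequence

  infixl 6 _+_
  infix  8 -_
  infix  4 _∼_ _⪯_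

  _∼_ : Rel G ℓ
  (a , b) ∼ (x , y) = a +ᴹ y ≈ᴹ x +ᴹ b

  _⪯_ : Rel G ℓ
  (a , b) ⪯ (x , y) = a +ᴹ y ≤ᴹ x +ᴹ b

  _+_ : Op₂ G
  (a , b) + (x , y) = (a +ᴹ x , b +ᴹ y)

  -_ : Op₁ G
  - (a , b) = (b , a)

  id : G
  id = (⟦ 0̄ ⟧ , ⟦ 0̄ ⟧)

  u : G
  u = (⟦ 1̄ ⟧ , ⟦ 0̄ ⟧)

{-# OPTIONS --safe #-}
module Submission where

-- Since ⟦ x ⟧ + ⟦ ¬ x ⟧ = ⟦ 1̄ ⟧ and adding ⟦ 1̄ ⟧ merely shifts a good sequence,
-- every good sequence, being the sum of its entries ⟦ aᵢ ⟧, divides a multiple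
-- of ⟦ 1̄ ⟧.  Cancellation, and compatibility of addition with componentwise
-- joins, are therefore inherited from the shift.  Associativity reduces to
-- a + ⟦ x ⟧ + ⟦ y ⟧ = a + ⟦ y ⟧ + ⟦ x ⟧, which is an MV-identity; no
-- representation by totally ordered algebras is needed.  Finally k = κ x has
-- k ⊕ k = 1̄ and k ⊙ k = x, that is 2 ⟦ κ x ⟧ = ⟦ x ⟧ + ⟦ 1̄ ⟧, so that
-- ⟦ x ⟧ = 2 (⟦ κ x ⟧ − ⟦ κ 0̄ ⟧).

open import Defs
open import Algebra.Bundles using (CommutativeMonoid; RawMonoid)
open import Algebra.Core using (Op₁; Op₂)
open import Algebra.Definitions using (_DistributesOverʳ_)
import Algebra.Definitions.RawMonoid as Multiples
import Algebra.Solver.CommutativeMonoid as CommutativeMonoidSolver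
open import Algebra.Structures using (IsAbelianGroup; IsCommutativeMonoid)
open import Data.Nat.Base as ℕ using (ℕ; zero; suc; _∸_; z≤n; s≤s)
import Data.Nat.Properties as ℕₚ
open import Data.Product using (_×_; Σ-syntax; ∃; ∃₂; _,_; proj₁; proj₂)
open import Function.Base using (_∘_)
open import Function.Bundles using (_⇔_; mk⇔; Equivalence)
open import Level using (_⊔_) renaming (suc to lsuc)
open import Relation.Binary.Bundles using (Setoid)
open import Relation.Binary.Core using (Rel)
open import Relation.Binary.Lattice using (Lattice; Supremum; Infimum)
open import Relation.Binary.Lattice.Properties.Lattice using (isAlgLattice)
import Relation.Binary.Reasoning.Setoid as SetoidReasoning
open import Relation.Binary.Structures using (IsEquivalence; IsPartialOrder)

-- Generators of a commutative monoid, complements and halves.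

data Generated {c ℓ x} (M : CommutativeMonoid c ℓ) {X : Set x}
               (gen : X → CommutativeMonoid.Carrier M) :
               CommutativeMonoid.Carrier M → Set (c ⊔ ℓ ⊔ x) where
  empty  : ∀ {a} → let open CommutativeMonoid M in a ≈ ε → Generated M gen a
  extend : ∀ {a b} y → Generated M gen b →
           let open CommutativeMonoid M in a ≈ b ∙ gen y → Generated M gen a

-- A half of `a` may exist only as a formal difference `s - t`; clearing the subtraction from
-- `2 (s - t) = a` gives this equation inside the monoid.
Halves : ∀ {c ℓ} (M : CommutativeMonoid c ℓ) → CommutativeMonoid.Carrier M → Set (c ⊔ ℓ)
Halves M a = ∃₂ λ s t → (s ∙ s) ≈ (a ∙ (t ∙ t))
  where open CommutativeMonoid M

module _ {c ℓ x} (M : CommutativeMonoid c ℓ) {X : Set x}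
         (gen : X → CommutativeMonoid.Carrier M) where
  open CommutativeMonoid M
  open Multiples rawMonoid using () renaming (_×_ to _·_)
  open CommutativeMonoidSolver M using (solve; _⊜_) renaming (_⊕_ to _⊞_; id to ∅)
  open SetoidReasoning setoid

  -- Complements of the generators add up, so `n` counts the generators used and each contributes
  -- one copy of `e`.
  generated⇒complemented : ∀ {e} → (∀ y → ∃ λ b → gen y ∙ b ≈ e) →
                           ∀ {a} → Generated M gen a → ∃₂ λ n b → a ∙ b ≈ n · e
  generated⇒complemented inv (empty a≈ε) = 0 , ε , trans (identityʳ _) a≈ε
  generated⇒complemented {e} inv {a} (extend {b = b} y g a≈) =
    let n , b* , p = generated⇒complemented inv g
        y* , q     = inv y
    in suc n , b* ∙ y* , (begin
      a ∙ (b* ∙ y*)              ≈⟨ ∙-congʳ a≈ ⟩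
      (b ∙ gen y) ∙ (b* ∙ y*)    ≈⟨ solve 4 (λ b g b* y* → (b ⊞ g) ⊞ (b* ⊞ y*) ⊜ (g ⊞ y*) ⊞ (b ⊞ b*))
                                      refl b (gen y) b* y* ⟩
      (gen y ∙ y*) ∙ (b ∙ b*)    ≈⟨ ∙-cong q p ⟩
      e ∙ n · e                  ∎)

  generated⇒halves : (∀ y → Halves M (gen y)) → ∀ {a} → Generated M gen a → Halves M a
  generated⇒halves half {a} (empty a≈ε) = ε , ε , (begin
    ε ∙ ε         ≈⟨ solve 0 (∅ ⊞ ∅ ⊜ ∅ ⊞ (∅ ⊞ ∅)) refl ⟩
    ε ∙ (ε ∙ ε)   ≈⟨ ∙-congʳ a≈ε ⟨
    a ∙ (ε ∙ ε)   ∎)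
  generated⇒halves half {a} (extend {b = b} y g a≈) =
    let s , t , p = generated⇒halves half g
        v , w , q = half y
    in s ∙ v , t ∙ w , (begin
      (s ∙ v) ∙ (s ∙ v)                    ≈⟨ solve 2 (λ s v → (s ⊞ v) ⊞ (s ⊞ v) ⊜ (s ⊞ s) ⊞ (v ⊞ v)) refl s v ⟩
      (s ∙ s) ∙ (v ∙ v)                    ≈⟨ ∙-cong p q ⟩
      (b ∙ (t ∙ t)) ∙ (gen y ∙ (w ∙ w))    ≈⟨ solve 4 (λ b t g w → (b ⊞ (t ⊞ t)) ⊞ (g ⊞ (w ⊞ w))
                                                ⊜ (b ⊞ g) ⊞ ((t ⊞ w) ⊞ (t ⊞ w))) refl b t (gen y) w ⟩
      (b ∙ gen y) ∙ ((t ∙ w) ∙ (t ∙ w))    ≈⟨ ∙-congʳ a≈ ⟨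
      a ∙ ((t ∙ w) ∙ (t ∙ w))              ∎)

-- Ordered monoids with a unit.

-- The axioms ask for cancellation and distributivity over joins only for e;
-- complement extends both to all elements.
record UnitOrderedMonoid c ℓ : Set (lsuc (c ⊔ ℓ)) where
  field
    commutativeMonoid : CommutativeMonoid c ℓ
  open CommutativeMonoid commutativeMonoid public
  open Multiples rawMonoid using () renaming (_×_ to _·_) public
  infix 4 _≤_
  field
    _≤_            : Rel Carrier ℓ
    isPartialOrder : IsPartialOrder _≈_ _≤_
    ∙-monoˡ        : ∀ {a b} c → a ≤ b → a ∙ c ≤ b ∙ c
    ε-minimum      : ∀ a → ε ≤ a
    _⋎_            : Op₂ Carrier
    ⋎-supremum     : Supremum _≤_ _⋎_
    e              : Carrier
    e-cancel       : ∀ {a b} → a ∙ e ≤ b ∙ e → a ≤ b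
    e-⋎            : ∀ a b → (a ⋎ b) ∙ e ≤ (a ∙ e) ⋎ (b ∙ e)
    complement     : ∀ a → ∃₂ λ n b → a ∙ b ≈ n · e

module UnitOrderedMonoidProperties {c ℓ} (M : UnitOrderedMonoid c ℓ) where
  open UnitOrderedMonoid M
  open IsPartialOrder isPartialOrder public
    using (antisym) renaming (refl to ≤-refl; trans to ≤-trans; reflexive to ≤-reflexive)
  open CommutativeMonoidSolver commutativeMonoid using (solve; _⊜_) renaming (_⊕_ to _⊞_)

  ≤-resp : ∀ {a a′ b b′} → a ≈ a′ → b ≈ b′ → a ≤ b → a′ ≤ b′
  ≤-resp p q a≤b = ≤-trans (≤-reflexive (sym p)) (≤-trans a≤b (≤-reflexive q))

  a≤a∙b : ∀ a b → a ≤ a ∙ b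
  a≤a∙b a b = ≤-resp (identityˡ a) (comm b a) (∙-monoˡ a (ε-minimum b))

  x≤x⋎y : ∀ x y → x ≤ x ⋎ y
  x≤x⋎y x y = proj₁ (⋎-supremum x y)

  y≤x⋎y : ∀ x y → y ≤ x ⋎ y
  y≤x⋎y x y = proj₁ (proj₂ (⋎-supremum x y))

  ⋎-least : ∀ {x y z} → x ≤ z → y ≤ z → x ⋎ y ≤ z
  ⋎-least {x} {y} {z} = proj₂ (proj₂ (⋎-supremum x y)) z

  n·e-cancel : ∀ n {a b} → a ∙ n · e ≤ b ∙ n · e → a ≤ b
  n·e-cancel zero    p = ≤-resp (identityʳ _) (identityʳ _) p
  n·e-cancel (suc n) p = e-cancel (n·e-cancel n (≤-resp (sym (assoc _ _ _)) (sym (assoc _ _ _)) p))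

  -- Distributivity phrased through upper bounds suits the induction: `e-⋎` moves one `e` inside the
  -- join, and the hypothesis applies to `p ∙ e` and `q ∙ e`.
  n·e-⋎-least : ∀ n {p q r} → p ∙ n · e ≤ r → q ∙ n · e ≤ r → (p ⋎ q) ∙ n · e ≤ r
  n·e-⋎-least zero    p q = ≤-resp (sym (identityʳ _)) refl
    (⋎-least (≤-resp (identityʳ _) refl p) (≤-resp (identityʳ _) refl q))
  n·e-⋎-least (suc n) p q = ≤-trans (≤-reflexive (sym (assoc _ _ _)))
    (≤-trans (∙-monoˡ _ (e-⋎ _ _))
      (n·e-⋎-least n (≤-resp (sym (assoc _ _ _)) refl p) (≤-resp (sym (assoc _ _ _)) refl q)))

  -- Adding a complement of `f` to both sides turns `f` into a multiple of `e`, which cancels.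
  ∙-cancel : ∀ f {a b} → a ∙ f ≤ b ∙ f → a ≤ b
  ∙-cancel f {a} {b} p with complement f
  ... | n , f* , f∙f*≈ = n·e-cancel n (≤-resp (through a) (through b) (∙-monoˡ f* p))
    where
    through : ∀ x → (x ∙ f) ∙ f* ≈ x ∙ n · e
    through x = trans (assoc x f f*) (∙-congˡ f∙f*≈)

  ∙-⋎-least : ∀ f {p q r} → p ∙ f ≤ r → q ∙ f ≤ r → (p ⋎ q) ∙ f ≤ r
  ∙-⋎-least f {p} {q} {r} p≤ q≤ with complement f
  -- The complement `f*` is added to both sides, so that the join is translated by `n · e`, and is
  -- cancelled again at the end.
  ... | n , f* , f∙f*≈ = ∙-cancel f* (≤-resp (sym (through _)) refl
        (n·e-⋎-least n (≤-resp (through p) refl (∙-monoˡ f* p≤)) (≤-resp (through q) refl (∙-monoˡ f* q≤))))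
    where
    through : ∀ x → (x ∙ f) ∙ f* ≈ x ∙ n · e
    through x = trans (assoc x f f*) (∙-congˡ f∙f*≈)

  -- A complement of the sum `a ∙ b` yields one `n` for both; the strong unit must bound `(a , b)`
  -- and its negative at once.
  bounded₂ : ∀ a b → ∃ λ n → a ≤ n · e × b ≤ n · e
  bounded₂ a b with complement (a ∙ b)
  ... | n , f , eq = n , ≤-resp refl (trans (sym (assoc a b f)) eq) (a≤a∙b a (b ∙ f))
                   , ≤-resp refl (trans (solve 3 (λ a b f → b ⊞ (a ⊞ f) ⊜ (a ⊞ b) ⊞ f) refl a b f) eq)
                            (a≤a∙b b (a ∙ f))

-- The lattice-ordered group of formal differences.

module DifferenceGroup {c ℓ} (M : UnitOrderedMonoid c ℓ) where
  open UnitOrderedMonoid M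
  open UnitOrderedMonoidProperties M
  open CommutativeMonoidSolver commutativeMonoid using (solve; _⊜_) renaming (_⊕_ to _⊞_; id to ∅)

  G : Set c
  G = Carrier × Carrier

  infix  4 _∼_ _⪯_
  infixl 5 _∨_ _∧_
  infixl 6 _+_
  infix  8 -_

  _∼_ : Rel G ℓ
  (a , b) ∼ (x , y) = a ∙ y ≈ x ∙ b

  _⪯_ : Rel G ℓ
  (a , b) ⪯ (x , y) = a ∙ y ≤ x ∙ b

  _+_ : Op₂ G
  (a , b) + (x , y) = (a ∙ x , b ∙ y)

  -_ : Op₁ G
  - (a , b) = (b , a)

  0ᴳ : G
  0ᴳ = (ε , ε)

  u : G
  u = (e , ε)

  -- Both differences are first rewritten with the common subtrahend `b ∙ y`.
  _∨_ : Op₂ G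
  (a , b) ∨ (x , y) = ((a ∙ y) ⋎ (x ∙ b) , b ∙ y)

  _∧_ : Op₂ G
  x ∧ y = - (- x ∨ - y)

  ⪯-refl : ∀ {x} → x ⪯ x
  ⪯-refl = ≤-refl

  -- After adding `q` to the first inequality and `b` to the second, both meet at `(x ∙ q) ∙ b`, and
  -- the leftover `y` cancels.
  ⪯-trans : ∀ {x y z} → x ⪯ y → y ⪯ z → x ⪯ z
  ⪯-trans {a , b} {x , y} {p , q} x⪯y y⪯z = ∙-cancel y (≤-trans
    (≤-resp (swap a y q) (swap x b q) (∙-monoˡ q x⪯y))
    (≤-resp refl (swap p y b) (∙-monoˡ b y⪯z)))
    where
    swap : ∀ a b c → (a ∙ b) ∙ c ≈ (a ∙ c) ∙ b
    swap = solve 3 (λ a b c → (a ⊞ b) ⊞ c ⊜ (a ⊞ c) ⊞ b) refl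

  ∼-isEquivalence : IsEquivalence _∼_
  ∼-isEquivalence = record
    { refl  = refl
    ; sym   = sym
    -- Cancellation is stated for `≤`, so transitivity of `∼` comes from `⪯` in both directions.
    ; trans = λ {x} {y} {z} p q → antisym
        (⪯-trans {x} {y} {z} (≤-reflexive p) (≤-reflexive q))
        (⪯-trans {z} {y} {x} (≤-reflexive (sym q)) (≤-reflexive (sym p))) }

  ⪯-isPartialOrder : IsPartialOrder _∼_ _⪯_
  ⪯-isPartialOrder = record
    { isPreorder = record
      { isEquivalence = ∼-isEquivalence
      ; reflexive     = ≤-reflexive
      ; trans         = λ {x} {y} {z} → ⪯-trans {x} {y} {z} }
    ; antisym = antisym }

  -‿anti : ∀ x y → x ⪯ y → - y ⪯ - x
  -‿anti (a , b) (x , y) = ≤-resp (comm a y) (comm x b)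

  ∨-supremum : Supremum _⪯_ _∨_
  ∨-supremum (a , b) (x , y) =
      ≤-resp (solve 3 (λ a b y → (a ⊞ y) ⊞ b ⊜ a ⊞ (b ⊞ y)) refl a b y) refl
        (∙-monoˡ b (x≤x⋎y _ _))
    , ≤-resp (solve 3 (λ b x y → (x ⊞ b) ⊞ y ⊜ x ⊞ (b ⊞ y)) refl b x y) refl
        (∙-monoˡ y (y≤x⋎y _ _))
    -- Leastness carries the extra summand `q` outside the join, which is exactly the form that
    -- `∙-⋎-least` handles.
    , λ (p , q) l r → ∙-⋎-least q
        (≤-resp (solve 3 (λ a y q → (a ⊞ q) ⊞ y ⊜ (a ⊞ y) ⊞ q) refl a y q) (assoc p b y) (∙-monoˡ y l))
        (≤-resp (solve 3 (λ x b q → (x ⊞ q) ⊞ b ⊜ (x ⊞ b) ⊞ q) refl x b q)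
                (solve 3 (λ p b y → (p ⊞ y) ⊞ b ⊜ p ⊞ (b ⊞ y)) refl p b y) (∙-monoˡ b r))

  ∧-infimum : Infimum _⪯_ _∧_
  ∧-infimum x y =
    let l , r , least = ∨-supremum (- x) (- y) in
      -‿anti (- x) (- x ∨ - y) l
    , -‿anti (- y) (- x ∨ - y) r
    , λ z z⪯x z⪯y → -‿anti (- x ∨ - y) (- z) (least (- z) (-‿anti z x z⪯x) (-‿anti z y z⪯y))

  lattice : Lattice c ℓ ℓ
  lattice = record { isLattice = record
    { isPartialOrder = ⪯-isPartialOrder ; supremum = ∨-supremum ; infimum = ∧-infimum } }

  +-isAbelianGroup : IsAbelianGroup _∼_ _+_ 0ᴳ -_
  +-isAbelianGroup = record
    { isGroup = record
      { isMonoid = record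
        { isSemigroup = record
          { isMagma = record
            { isEquivalence = ∼-isEquivalence
            ; ∙-cong = λ { {a , b} {x , y} {p , q} {v , w} a∼x p∼v →
                trans (interchange a p y w) (trans (∙-cong a∼x p∼v) (interchange x b v q)) } }
          ; assoc = λ (a , b) (x , y) (p , q) → ∙-cong (assoc a x p) (sym (assoc b y q)) }
        ; identity = (λ (a , b) → solve 2 (λ a b → (∅ ⊞ a) ⊞ b ⊜ a ⊞ (∅ ⊞ b)) refl a b)
                   , (λ (a , b) → solve 2 (λ a b → (a ⊞ ∅) ⊞ b ⊜ a ⊞ (b ⊞ ∅)) refl a b) }
      ; inverse = (λ (a , b) → solve 2 (λ a b → (b ⊞ a) ⊞ ∅ ⊜ ∅ ⊞ (a ⊞ b)) refl a b)
                , (λ (a , b) → solve 2 (λ a b → (a ⊞ b) ⊞ ∅ ⊜ ∅ ⊞ (b ⊞ a)) refl a b)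
      ; ⁻¹-cong = λ { {a , b} {x , y} p → trans (comm b x) (trans (sym p) (comm a y)) } }
    ; comm = λ (a , b) (x , y) → ∙-cong (comm a x) (comm y b) }
    where
    interchange : ∀ a b c d → (a ∙ b) ∙ (c ∙ d) ≈ (a ∙ c) ∙ (b ∙ d)
    interchange = solve 4 (λ a b c d → (a ⊞ b) ⊞ (c ⊞ d) ⊜ (a ⊞ c) ⊞ (b ⊞ d)) refl

  +-monoˡ : ∀ z x y → x ⪯ y → x + z ⪯ y + z
  +-monoˡ (p , q) (a , b) (x , y) l =
    ≤-resp (solve 4 (λ a y p q → (a ⊞ y) ⊞ (p ⊞ q) ⊜ (a ⊞ p) ⊞ (y ⊞ q)) refl a y p q)
           (solve 4 (λ x b p q → (x ⊞ b) ⊞ (p ⊞ q) ⊜ (x ⊞ p) ⊞ (b ⊞ q)) refl x b p q)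
           (∙-monoˡ (p ∙ q) l)

  +-residual : ∀ z x y → x + z ⪯ y → x ⪯ y + (- z)
  +-residual (p , q) (a , b) (x , y) =
    ≤-resp (solve 3 (λ a y p → (a ⊞ p) ⊞ y ⊜ a ⊞ (y ⊞ p)) refl a y p)
           (solve 3 (λ x b q → x ⊞ (b ⊞ q) ⊜ (x ⊞ q) ⊞ b) refl x b q)

  +-residual⁻¹ : ∀ z x y → x ⪯ y + (- z) → x + z ⪯ y
  +-residual⁻¹ (p , q) (a , b) (x , y) =
    ≤-resp (solve 3 (λ a y p → a ⊞ (y ⊞ p) ⊜ (a ⊞ p) ⊞ y) refl a y p)
           (solve 3 (λ x b q → (x ⊞ q) ⊞ b ⊜ x ⊞ (b ⊞ q)) refl x b q)

  -- Translation by `x` is an order isomorphism with inverse translation by `- x`, so it preserves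
  -- joins.
  +-distribʳ-∨ : _DistributesOverʳ_ _∼_ _+_ _∨_
  +-distribʳ-∨ x y z =
    let y⪯y∨z , z⪯y∨z , y∨z-least = ∨-supremum y z
        l , r , least = ∨-supremum (y + x) (z + x)
        w = (y + x) ∨ (z + x)
    in antisym
      (+-residual⁻¹ x (y ∨ z) w (y∨z-least (w + (- x)) (+-residual x y w l) (+-residual x z w r)))
      (least ((y ∨ z) + x) (+-monoˡ x y (y ∨ z) y⪯y∨z) (+-monoˡ x z (y ∨ z) z⪯y∨z))

  -- `IsℓuGroup` reads its order off the meet; this identifies that order with `⪯`.
  ⪯⇔∧ : ∀ x y → (x ⪯ y) ⇔ ((x ∧ y) ∼ x)
  ⪯⇔∧ x y =
    let x∧y⪯x , x∧y⪯y , greatest = ∧-infimum x y in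
    mk⇔ (λ x⪯y → antisym x∧y⪯x (greatest x (⪯-refl {x}) x⪯y))
        (λ x∧y∼x → ⪯-trans {x} {x ∧ y} {y} (≤-reflexive (sym x∧y∼x)) x∧y⪯y)

  +-rawMonoid : RawMonoid c ℓ
  +-rawMonoid = record { Carrier = G ; _≈_ = _∼_ ; _∙_ = _+_ ; ε = 0ᴳ }

  isℓuGroup : IsℓuGroup _∼_ _+_ -_ 0ᴳ _∨_ _∧_ u
  isℓuGroup = record
    { isAbelianGroup = +-isAbelianGroup
    ; isLattice      = isAlgLattice lattice
    ; +-distribʳ-∨   = +-distribʳ-∨
    ; strongUnit     = strongUnit }
    where
    open Multiples +-rawMonoid using () renaming (_×_ to _·ᴳ_)

    n·u : ∀ n → proj₁ (n ·ᴳ u) ≈ n · e × proj₂ (n ·ᴳ u) ≈ ε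
    n·u zero    = refl , refl
    n·u (suc n) = let p , q = n·u n in ∙-congˡ p , trans (identityˡ _) q

    ⪯n·u : ∀ n a b → a ≤ n · e → (a , b) ⪯ (n ·ᴳ u)
    ⪯n·u n a b a≤ = let p , q = n·u n in
      ≤-resp (sym (trans (∙-congˡ q) (identityʳ a))) (∙-congʳ (sym p)) (≤-trans a≤ (a≤a∙b (n · e) b))

    strongUnit : ∀ x → ∃ λ n → ((x ∨ (- x)) ∧ (n ·ᴳ u)) ∼ (x ∨ (- x))
    strongUnit x@(a , b) =
      let n , a≤ , b≤ = bounded₂ a b
          _ , _ , least = ∨-supremum x (- x)
      in n , Equivalence.to (⪯⇔∧ (x ∨ (- x)) (n ·ᴳ u)) (least (n ·ᴳ u) (⪯n·u n a b a≤) (⪯n·u n b a b≤))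

  halves⇒twoDivisible : (∀ a → Halves commutativeMonoid a) → TwoDivisible _∼_ _+_
  halves⇒twoDivisible half (a , b) =
    let s , t , p = half a
        v , w , q = half b
    -- Here `s - t` halves `a` and `v - w` halves `b`; the witness is `(s - t) - (v - w)`.
    in (s ∙ w , v ∙ t) , (begin
      a ∙ ((v ∙ t) ∙ (v ∙ t))          ≈⟨ solve 3 (λ a v t → a ⊞ ((v ⊞ t) ⊞ (v ⊞ t)) ⊜ (a ⊞ (t ⊞ t)) ⊞ (v ⊞ v)) refl a v t ⟩
      (a ∙ (t ∙ t)) ∙ (v ∙ v)          ≈⟨ ∙-cong (sym p) q ⟩
      (s ∙ s) ∙ (b ∙ (w ∙ w))          ≈⟨ solve 3 (λ s b w → (s ⊞ s) ⊞ (b ⊞ (w ⊞ w)) ⊜ ((s ⊞ w) ⊞ (s ⊞ w)) ⊞ b) refl s b w ⟩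
      ((s ∙ w) ∙ (s ∙ w)) ∙ b          ∎)
    where open SetoidReasoning setoid

-- Identities in MV-algebras.

module MVLemmas {c ℓ} (A : MVAlgebra c ℓ) where
  open MVAlgebra A
  open MVProperties A
  open IsEquivalence isEquivalence using (refl; sym; trans)

  ⊕-commutativeMonoid : CommutativeMonoid c ℓ
  ⊕-commutativeMonoid = record
    { isCommutativeMonoid = record
      { isMonoid = record
        { isSemigroup = record
          { isMagma = record { isEquivalence = isEquivalence ; ∙-cong = ⊕-cong }
          ; assoc = ⊕-assoc }
        ; identity = ⊕-identityˡ , ⊕-identityʳ }
      ; comm = ⊕-comm } }

  ⊙-commutativeMonoid : CommutativeMonoid c ℓ
  ⊙-commutativeMonoid = record
    { isCommutativeMonoid = record
      { isMonoid = record
        { isSemigroup = record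
          { isMagma = record { isEquivalence = isEquivalence ; ∙-cong = ⊙-cong }
          ; assoc = ⊙-assoc }
        ; identity = ⊙-identityˡ , ⊙-identityʳ }
      ; comm = ⊙-comm } }

  module ⊕-Solver = CommutativeMonoidSolver ⊕-commutativeMonoid using (solve; _⊜_) renaming (_⊕_ to _⊞_)
  module ⊙-Solver = CommutativeMonoidSolver ⊙-commutativeMonoid using (solve; _⊜_) renaming (_⊕_ to _⊡_)

  ≤-refl : ∀ {x} → x ≤ x
  ≤-refl = ≤-reflexive refl

  x≤x⊕y : ∀ x y → x ≤ x ⊕ y
  x≤x⊕y x y = ≤-respʳ (⊕-comm y x) (y≤x⊕y y x)

  ≤⇒⊙⊕ : ∀ {x y} → x ≤ y → y ≈ y ⊙ ¬ x ⊕ x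
  ≤⇒⊙⊕ x≤y = trans (≤⇒diff x≤y) (⊕-congʳ (¬-cong (⊕-congˡ (sym (¬-involutive _)))))

  infixl 6 _∨_
  -- The standard join of an MV-algebra; its symmetry is the axiom `łukasiewicz`.
  _∨_ : Op₂ Carrier
  x ∨ y = ¬ (¬ x ⊕ y) ⊕ y

  x≤x∨y : ∀ x y → x ≤ x ∨ y
  x≤x∨y x y = ≤-respʳ (łukasiewicz y x) (y≤x⊕y _ x)

  y≤x∨y : ∀ x y → y ≤ x ∨ y
  y≤x∨y x y = y≤x⊕y _ y

  -- From `y ≤ z` one gets `z ≈ z ∨ y`, and `∨` is monotone in its first argument.
  ∨-least : ∀ {x y z} → x ≤ z → y ≤ z → x ∨ y ≤ z
  ∨-least {x} {y} {z} x≤z y≤z = ≤-respʳ (sym (≤⇒diff y≤z))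
    (⊕-mono (¬-anti (⊕-mono (¬-anti x≤z) ≤-refl)) ≤-refl)

  ∨≤⊕ : ∀ x y → x ∨ y ≤ x ⊕ y
  ∨≤⊕ x y = ∨-least (x≤x⊕y x y) (y≤x⊕y x y)

  -- Both sides are the join of `¬ x` and `y`, one for each order of the arguments.
  ¬x⊕[x⊙y] : ∀ x y → ¬ x ⊕ x ⊙ y ≈ ¬ (x ⊕ y) ⊕ y
  ¬x⊕[x⊙y] x y = begin
    ¬ x ⊕ x ⊙ y              ≈⟨ ⊕-comm _ _ ⟩
    x ⊙ y ⊕ ¬ x              ≈⟨ ⊕-congʳ (⊙-comm x y) ⟩
    y ⊙ x ⊕ ¬ x              ≈⟨ łukasiewicz y (¬ x) ⟩
    ¬ (¬ ¬ x ⊕ y) ⊕ y        ≈⟨ ⊕-congʳ (¬-cong (⊕-congʳ (¬-involutive x))) ⟩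
    ¬ (x ⊕ y) ⊕ y            ∎
    where open ≈R

  -- The expression `x ⊙ (¬ x ⊕ y)` is the meet of `x` and `y`, symmetric by `meet-comm`.
  ≥⇒meet : ∀ {x y} → y ≤ x → x ⊙ (¬ x ⊕ y) ≈ y
  ≥⇒meet {x} {y} y≤x = begin
    x ⊙ (¬ x ⊕ y)   ≈⟨ meet-comm x y ⟩
    y ⊙ (¬ y ⊕ x)   ≈⟨ ⊙-cong refl y≤x ⟩
    y ⊙ 1̄           ≈⟨ ⊙-identityʳ y ⟩
    y               ∎
    where open ≈R

  absorb-anti : ∀ {x s t} → s ≤ t → x ⊕ t ≈ x → x ⊕ s ≈ x
  absorb-anti {x} {s} {t} s≤t e = ≤-antisym (≤-respʳ e (⊕-monoˡ x s≤t)) (x≤x⊕y x s)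

  absorb-⊕ : ∀ {x s t} → x ⊕ s ≈ x → x ⊕ t ≈ x → x ⊕ (s ⊕ t) ≈ x
  absorb-⊕ es et = trans (sym (⊕-assoc _ _ _)) (trans (⊕-congʳ es) et)

  -- Both sides lie below c, so they may be compared after adding ¬ c.
  ⊙-⊕-absorbed : ∀ {c q} p → c ⊕ q ≈ c → c ⊙ (p ⊕ q) ≈ c ⊙ p ⊕ q
  ⊙-⊕-absorbed {c} {q} p c⊕q≈c = begin
    c ⊙ (p ⊕ q)                    ≈⟨ ≥⇒meet (x⊙y≤x c (p ⊕ q)) ⟨
    c ⊙ (¬ c ⊕ c ⊙ (p ⊕ q))        ≈⟨ ⊙-cong refl (¬x⊕[x⊙y] c (p ⊕ q)) ⟩
    c ⊙ (¬ (c ⊕ (p ⊕ q)) ⊕ (p ⊕ q)) ≈⟨ ⊙-cong refl (⊕-congʳ (¬-cong c⊕p⊕q)) ⟩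
    c ⊙ (¬ (c ⊕ p) ⊕ (p ⊕ q))      ≈⟨ ⊙-cong refl (⊕-assoc _ _ _) ⟨
    c ⊙ (¬ (c ⊕ p) ⊕ p ⊕ q)        ≈⟨ ⊙-cong refl (⊕-congʳ (¬x⊕[x⊙y] c p)) ⟨
    c ⊙ (¬ c ⊕ c ⊙ p ⊕ q)          ≈⟨ ⊙-cong refl (⊕-assoc _ _ _) ⟩
    c ⊙ (¬ c ⊕ (c ⊙ p ⊕ q))        ≈⟨ ≥⇒meet (≤-respʳ c⊕q≈c (⊕-mono (x⊙y≤x c p) ≤-refl)) ⟩
    c ⊙ p ⊕ q                      ∎
    where
    open ≈R
    c⊕p⊕q : c ⊕ (p ⊕ q) ≈ c ⊕ p
    c⊕p⊕q = trans (solve 3 (λ c p q → c ⊞ (p ⊞ q) ⊜ (c ⊞ q) ⊞ p) refl c p q) (⊕-congʳ c⊕q≈c)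
      where open ⊕-Solver

  -- As `q ⊙ x ≤ z ⊙ x`, the remainder is `z ⊙ x ⊙ ¬ (q ⊙ x)`. In it `x ⊙ ¬ (q ⊙ x)` is the meet of
  -- `x` and `¬ q`, rewritten so that `x` occurs only in `q ⊕ x`.
  ⊙-split : ∀ {q z} x → q ≤ z → z ⊙ x ≈ z ⊙ (¬ q ⊙ (q ⊕ x)) ⊕ q ⊙ x
  ⊙-split {q} {z} x q≤z = begin
    z ⊙ x                                ≈⟨ ≤⇒⊙⊕ (⊙-monoʳ x q≤z) ⟩
    z ⊙ x ⊙ ¬ (q ⊙ x) ⊕ q ⊙ x            ≈⟨ ⊕-congʳ rest ⟩
    z ⊙ (¬ q ⊙ (q ⊕ x)) ⊕ q ⊙ x          ∎
    where
    open ≈R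
    rest : z ⊙ x ⊙ ¬ (q ⊙ x) ≈ z ⊙ (¬ q ⊙ (q ⊕ x))
    rest = begin
      z ⊙ x ⊙ ¬ (q ⊙ x)         ≈⟨ ⊙-assoc _ _ _ ⟩
      z ⊙ (x ⊙ ¬ (q ⊙ x))       ≈⟨ ⊙-cong refl (⊙-cong refl (trans (¬-involutive _) (⊕-comm _ _))) ⟩
      z ⊙ (x ⊙ (¬ x ⊕ ¬ q))     ≈⟨ ⊙-cong refl (meet-comm x (¬ q)) ⟩
      z ⊙ (¬ q ⊙ (¬ ¬ q ⊕ x))   ≈⟨ ⊙-cong refl (⊙-cong refl (⊕-congʳ (¬-involutive q))) ⟩
      z ⊙ (¬ q ⊙ (q ⊕ x))       ∎

  -- Both sides equal p ⊕ q ⊙ x ⊕ q ⊙ y ⊕ r ⊙ ¬ q ⊙ (q ⊕ x) ⊙ (q ⊕ y).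
  ⊙-exchange : ∀ {q r} p x y → r ⊕ q ≈ r →
               (p ⊕ q ⊙ x) ⊕ (q ⊕ r ⊙ x) ⊙ y ≈ (p ⊕ q ⊙ y) ⊕ (q ⊕ r ⊙ y) ⊙ x
  ⊙-exchange {q} {r} p x y r⊕q≈r =
    trans (expand x y) (trans shuffle (sym (expand y x)))
    where
    m : Op₂ Carrier
    m x y = r ⊙ (x ⊕ q) ⊙ (¬ q ⊙ (q ⊕ y))

    expand : ∀ x y → (p ⊕ q ⊙ x) ⊕ (q ⊕ r ⊙ x) ⊙ y ≈ (p ⊕ q ⊙ x) ⊕ (m x y ⊕ q ⊙ y)
    -- Splitting at `q` isolates `q ⊙ y`; since `r` absorbs `q`, the other factor `q ⊕ r ⊙ x`
    -- becomes `r ⊙ (x ⊕ q)`.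
    expand x y = ⊕-congˡ (trans (⊙-split y (x≤x⊕y q _)) (⊕-congʳ (⊙-cong
      (trans (⊕-comm _ _) (sym (⊙-⊕-absorbed x r⊕q≈r))) refl)))

    m-comm : m x y ≈ m y x
    m-comm = trans (⊙-cong (⊙-cong refl (⊕-comm x q)) refl)
      (trans (solve 4 (λ r s n t → (r ⊡ s) ⊡ (n ⊡ t) ⊜ (r ⊡ t) ⊡ (n ⊡ s)) refl r (q ⊕ x) (¬ q) (q ⊕ y))
             (⊙-cong (⊙-cong refl (⊕-comm q y)) refl))
      where open ⊙-Solver

    shuffle : (p ⊕ q ⊙ x) ⊕ (m x y ⊕ q ⊙ y) ≈ (p ⊕ q ⊙ y) ⊕ (m y x ⊕ q ⊙ x)
    shuffle = trans (⊕-congˡ (⊕-congʳ m-comm))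
      (solve 4 (λ p a m b → (p ⊞ a) ⊞ (m ⊞ b) ⊜ (p ⊞ b) ⊞ (m ⊞ a)) refl p (q ⊙ x) (m y x) (q ⊙ y))
      where open ⊕-Solver

-- Convolution sums and good sequences.

module GoodSequences {c ℓ} (A : MVAlgebra c ℓ) where
  open MVAlgebra A
  open MVProperties A
  open MVLemmas A
  open IsEquivalence isEquivalence using (refl; sym; trans)
  open ChangGroup A

  -- The inner sum of (a +ˢ b) i, defined without truncated subtraction.
  cross : Seq → Seq → ℕ → Carrier
  cross a b zero    = 0̄
  cross a b (suc n) = a n ⊙ b 0 ⊕ cross a (b ∘ suc) n

  ⨁-shift : ∀ n f → ⨁ (suc n) f ≈ f 0 ⊕ ⨁ n (f ∘ suc)
  ⨁-shift zero    f = ⊕-comm _ _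
  ⨁-shift (suc n) f = trans (⊕-congʳ (⨁-shift n f)) (⊕-assoc _ _ _)

  ⨁≈cross : ∀ a b n → ⨁ n (λ j → a (n ∸ suc j) ⊙ b j) ≈ cross a b n
  ⨁≈cross a b zero    = refl
  ⨁≈cross a b (suc n) = trans (⨁-shift n _) (⊕-congˡ (⨁≈cross a (b ∘ suc) n))

  +ˢ≈cross : ∀ a b n → (a +ˢ b) n ≈ a n ⊕ cross a b n ⊕ b n
  +ˢ≈cross a b n = ⊕-congʳ (⊕-congˡ (⨁≈cross a b n))

  -- The recursion from the opposite end of the sum, where `a` is shifted instead of `b`; playing
  -- the two against each other gives `cross-comm`.
  cross-suc′ : ∀ a b n → cross a b (suc n) ≈ a 0 ⊙ b n ⊕ cross (a ∘ suc) b n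
  cross-suc′ a b zero    = refl
  cross-suc′ a b (suc n) = trans (⊕-congˡ (cross-suc′ a (b ∘ suc) n))
    (solve 3 (λ x y z → x ⊞ (y ⊞ z) ⊜ y ⊞ (x ⊞ z)) refl _ _ _)
    where open ⊕-Solver

  cross-comm : ∀ a b n → cross a b n ≈ cross b a n
  cross-comm a b zero    = refl
  cross-comm a b (suc n) = trans (⊕-cong (⊙-comm _ _) (cross-comm a (b ∘ suc) n))
                                 (sym (cross-suc′ b a n))

  cross-mono : ∀ {a a′ b b′} → (∀ i → a i ≤ a′ i) → (∀ i → b i ≤ b′ i) →
               ∀ n → cross a b n ≤ cross a′ b′ n
  cross-mono p q zero    = ≤-refl
  cross-mono p q (suc n) = ⊕-mono (⊙-mono (p n) (q 0)) (cross-mono p (q ∘ suc) n)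

  cross-zero : ∀ a {b} → (∀ i → b i ≈ 0̄) → ∀ n → cross a b n ≈ 0̄
  cross-zero a z zero    = refl
  cross-zero a z (suc n) = trans
    (⊕-cong (trans (⊙-cong refl (z 0)) (⊙-zeroʳ _)) (cross-zero a (z ∘ suc) n)) (⊕-identityʳ 0̄)

  -- Each summand lies below an entry of `b`, and absorption passes to smaller elements and to sums.
  cross-absorbed : ∀ {x} a {b} → (∀ i → x ⊕ b i ≈ x) → ∀ n → x ⊕ cross a b n ≈ x
  cross-absorbed a e zero    = ⊕-identityʳ _
  cross-absorbed a e (suc n) = absorb-⊕
    (absorb-anti (≤-trans (≤-reflexive (⊙-comm _ _)) (x⊙y≤x _ _)) (e 0))
    (cross-absorbed a (e ∘ suc) n)

  good-≥ : ∀ {a} → IsGood a → ∀ i → a (suc i) ≤ a i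
  good-≥ g i = ≤-respʳ (g i) (y≤x⊕y _ _)

  head-absorbs : ∀ {a} → IsGood a → ∀ i → a 0 ⊕ a (suc i) ≈ a 0
  head-absorbs g zero    = g 0
  head-absorbs g (suc i) = absorb-anti (good-≥ g (suc i)) (head-absorbs g i)

  -- Order, congruence and commutativity of addition.

  ≈ᴹ-isEquivalence : IsEquivalence _≈ᴹ_
  ≈ᴹ-isEquivalence = record
    { refl  = λ _ → refl
    ; sym   = λ p i → sym (p i)
    ; trans = λ p q i → trans (p i) (q i) }

  ≤ᴹ-isPartialOrder : IsPartialOrder _≈ᴹ_ _≤ᴹ_
  ≤ᴹ-isPartialOrder = record
    { isPreorder = record
      { isEquivalence = ≈ᴹ-isEquivalence
      ; reflexive     = λ p i → ≤-reflexive (p i)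
      ; trans         = λ p q i → ≤-trans (p i) (q i) }
    ; antisym = λ p q i → ≤-antisym (p i) (q i) }

  ≈ᴹ-setoid : Setoid (c ⊔ ℓ) ℓ
  ≈ᴹ-setoid = record { isEquivalence = ≈ᴹ-isEquivalence }

  module ≈ᴹR = SetoidReasoning ≈ᴹ-setoid

  +ᴹ-mono : ∀ a b a′ b′ → a ≤ᴹ a′ → b ≤ᴹ b′ → a +ᴹ b ≤ᴹ a′ +ᴹ b′
  +ᴹ-mono a b a′ b′ p q i = begin
    seq (a +ᴹ b) i                                    ≈⟨ +ˢ≈cross (seq a) (seq b) i ⟩
    seq a i ⊕ cross (seq a) (seq b) i ⊕ seq b i       ≤⟨ ⊕-mono (⊕-mono (p i) (cross-mono p q i)) (q i) ⟩
    seq a′ i ⊕ cross (seq a′) (seq b′) i ⊕ seq b′ i   ≈⟨ +ˢ≈cross (seq a′) (seq b′) i ⟨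
    seq (a′ +ᴹ b′) i                                  ∎
    where open ≤R

  +ᴹ-cong : ∀ a b a′ b′ → a ≈ᴹ a′ → b ≈ᴹ b′ → a +ᴹ b ≈ᴹ a′ +ᴹ b′
  +ᴹ-cong a b a′ b′ p q i = ≤-antisym
    (+ᴹ-mono a b a′ b′ (≤-reflexive ∘ p) (≤-reflexive ∘ q) i)
    (+ᴹ-mono a′ b′ a b (≤-reflexive ∘ sym ∘ p) (≤-reflexive ∘ sym ∘ q) i)

  +ᴹ-congˡ : ∀ a b b′ → b ≈ᴹ b′ → a +ᴹ b ≈ᴹ a +ᴹ b′
  +ᴹ-congˡ a b b′ = +ᴹ-cong a b a b′ (λ _ → refl)

  +ᴹ-congʳ : ∀ b a a′ → a ≈ᴹ a′ → a +ᴹ b ≈ᴹ a′ +ᴹ b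
  +ᴹ-congʳ b a a′ p = +ᴹ-cong a b a′ b p (λ _ → refl)

  +ᴹ-comm : ∀ a b → a +ᴹ b ≈ᴹ b +ᴹ a
  +ᴹ-comm a b i = begin
    seq (a +ᴹ b) i                                ≈⟨ +ˢ≈cross (seq a) (seq b) i ⟩
    seq a i ⊕ cross (seq a) (seq b) i ⊕ seq b i   ≈⟨ ⊕-congʳ (⊕-congˡ (cross-comm (seq a) (seq b) i)) ⟩
    seq a i ⊕ cross (seq b) (seq a) i ⊕ seq b i   ≈⟨ solve 3 (λ x y z → (x ⊞ y) ⊞ z ⊜ (z ⊞ y) ⊞ x) refl _ _ _ ⟩
    seq b i ⊕ cross (seq b) (seq a) i ⊕ seq a i   ≈⟨ +ˢ≈cross (seq b) (seq a) i ⟨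
    seq (b +ᴹ a) i                                ∎
    where
    open ≈R
    open ⊕-Solver

  +ᴹ-vanishing : ∀ a b → (∀ i → seq b i ≈ 0̄) → a +ᴹ b ≈ᴹ a
  +ᴹ-vanishing a b z i = begin
    seq (a +ᴹ b) i                                ≈⟨ +ˢ≈cross (seq a) (seq b) i ⟩
    seq a i ⊕ cross (seq a) (seq b) i ⊕ seq b i   ≈⟨ ⊕-cong (⊕-congˡ (cross-zero (seq a) z i)) (z i) ⟩
    seq a i ⊕ 0̄ ⊕ 0̄                               ≈⟨ trans (⊕-identityʳ _) (⊕-identityʳ _) ⟩
    seq a i                                       ∎
    where open ≈R

  ⟦0⟧-vanishes : ∀ i → seq ⟦ 0̄ ⟧ i ≈ 0̄
  ⟦0⟧-vanishes zero    = refl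
  ⟦0⟧-vanishes (suc i) = refl

  +ᴹ-identityʳ : ∀ a → a +ᴹ ⟦ 0̄ ⟧ ≈ᴹ a
  +ᴹ-identityʳ a = +ᴹ-vanishing a ⟦ 0̄ ⟧ ⟦0⟧-vanishes

  +ᴹ-identityˡ : ∀ a → ⟦ 0̄ ⟧ +ᴹ a ≈ᴹ a
  +ᴹ-identityˡ a i = trans (+ᴹ-comm ⟦ 0̄ ⟧ a i) (+ᴹ-identityʳ a i)

  -- Adding a one-term sequence.

  +⟦⟧-zero : ∀ a x → seq (a +ᴹ ⟦ x ⟧) 0 ≈ seq a 0 ⊕ x
  +⟦⟧-zero a x = ⊕-congʳ (⊕-identityʳ _)

  +⟦⟧-suc : ∀ a x n → seq (a +ᴹ ⟦ x ⟧) (suc n) ≈ seq a (suc n) ⊕ seq a n ⊙ x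
  +⟦⟧-suc a x n = trans (+ˢ≈cross (seq a) (seq ⟦ x ⟧) (suc n)) (trans (⊕-identityʳ _)
    (⊕-congˡ (trans (⊕-congˡ (cross-zero (seq a) (λ _ → refl) n)) (⊕-identityʳ _))))

  -- Each entry depends on at most three consecutive entries of `a`; from index 1 on these are the
  -- `p`, `q`, `r` of `⊙-exchange`.
  +⟦⟧-exchange : ∀ a x y → (a +ᴹ ⟦ x ⟧) +ᴹ ⟦ y ⟧ ≈ᴹ (a +ᴹ ⟦ y ⟧) +ᴹ ⟦ x ⟧
  +⟦⟧-exchange a x y zero =
    trans (left x y) (trans (solve 3 (λ a x y → (a ⊞ x) ⊞ y ⊜ (a ⊞ y) ⊞ x) refl _ _ _) (sym (left y x)))
    where
    open ⊕-Solver
    left : ∀ x y → seq ((a +ᴹ ⟦ x ⟧) +ᴹ ⟦ y ⟧) 0 ≈ (seq a 0 ⊕ x) ⊕ y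
    left x y = trans (+⟦⟧-zero (a +ᴹ ⟦ x ⟧) y) (⊕-congʳ (+⟦⟧-zero a x))
  -- The missing entry before the head of `a` is taken to be `1̄`, which absorbs everything.
  +⟦⟧-exchange a x y (suc zero) =
    trans (left x y) (trans (⊙-exchange (seq a 1) x y (trans (⊕-comm _ _) (⊕-zeroʳ _))) (sym (left y x)))
    where
    left : ∀ x y → seq ((a +ᴹ ⟦ x ⟧) +ᴹ ⟦ y ⟧) 1 ≈
                   (seq a 1 ⊕ seq a 0 ⊙ x) ⊕ (seq a 0 ⊕ 1̄ ⊙ x) ⊙ y
    left x y = trans (+⟦⟧-suc (a +ᴹ ⟦ x ⟧) y 0) (⊕-cong (+⟦⟧-suc a x 0)
      (⊙-cong (trans (+⟦⟧-zero a x) (⊕-congˡ (sym (⊙-identityˡ x)))) refl))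
  +⟦⟧-exchange a x y (suc (suc n)) =
    trans (left x y) (trans (⊙-exchange (seq a (suc (suc n))) x y (isGood a n)) (sym (left y x)))
    where
    left : ∀ x y → seq ((a +ᴹ ⟦ x ⟧) +ᴹ ⟦ y ⟧) (suc (suc n)) ≈
                   (seq a (suc (suc n)) ⊕ seq a (suc n) ⊙ x) ⊕ (seq a (suc n) ⊕ seq a n ⊙ x) ⊙ y
    left x y = trans (+⟦⟧-suc (a +ᴹ ⟦ x ⟧) y (suc n))
      (⊕-cong (+⟦⟧-suc a x (suc n)) (⊙-cong (+⟦⟧-suc a x n) refl))

  -- Splitting off the head, and associativity.

  head : GoodSequence → Carrier
  head a = seq a 0

  tail : GoodSequence → GoodSequence
  tail a = record
    { seq            = seq a ∘ suc
    ; isGood         = isGood a ∘ suc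
    ; eventuallyZero = let (N , z) = eventuallyZero a in
                       N , λ i N≤i → z (suc i) (ℕₚ.m≤n⇒m≤1+n N≤i) }

  -- The terms of the right-hand side that do not occur on the left all lie
  -- below the next entry of a +ᴹ b, which a +ᴹ b absorbs because it is good.
  +ᴹ-peel : ∀ a b → a +ᴹ b ≈ᴹ (a +ᴹ tail b) +ᴹ ⟦ head b ⟧
  +ᴹ-peel a b zero = sym (begin
    seq ((a +ᴹ tail b) +ᴹ ⟦ head b ⟧) 0       ≈⟨ +⟦⟧-zero (a +ᴹ tail b) (head b) ⟩
    seq a 0 ⊕ 0̄ ⊕ seq b 1 ⊕ seq b 0           ≈⟨ ⊕-assoc _ _ _ ⟩
    seq a 0 ⊕ 0̄ ⊕ (seq b 1 ⊕ seq b 0)         ≈⟨ ⊕-congˡ (trans (⊕-comm _ _) (isGood b 0)) ⟩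
    seq a 0 ⊕ 0̄ ⊕ seq b 0                     ∎)
    where open ≈R
  +ᴹ-peel a b (suc n) = sym (begin
    seq ((a +ᴹ tail b) +ᴹ ⟦ head b ⟧) (suc n)             ≈⟨ +⟦⟧-suc (a +ᴹ tail b) b₀ n ⟩
    seq (a +ᴹ tail b) (suc n) ⊕ seq (a +ᴹ tail b) n ⊙ b₀  ≈⟨ ⊕-cong (+ˢ≈cross (seq a) b′ (suc n)) lower ⟩
    (aₙ₊₁ ⊕ e ⊕ bₙ₊₂) ⊕ (aₙ ⊙ b₀ ⊕ (d ⊕ bₙ₊₁))            ≈⟨ solve 6 (λ p e f x d q → ((p ⊞ e) ⊞ f) ⊞ (x ⊞ (d ⊞ q))
                                                               ⊜ ((p ⊞ (x ⊞ d)) ⊞ q) ⊞ (e ⊞ f)) refl aₙ₊₁ e bₙ₊₂ (aₙ ⊙ b₀) d bₙ₊₁ ⟩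
    (aₙ₊₁ ⊕ (aₙ ⊙ b₀ ⊕ d) ⊕ bₙ₊₁) ⊕ (e ⊕ bₙ₊₂)            ≈⟨ ⊕-congʳ (+ˢ≈cross (seq a) (seq b) (suc n)) ⟨
    seq (a +ᴹ b) (suc n) ⊕ (e ⊕ bₙ₊₂)                     ≈⟨ absorb-anti below (isGood (a +ᴹ b) (suc n)) ⟩
    seq (a +ᴹ b) (suc n)                                  ∎)
    where
    open ≈R
    open ⊕-Solver
    b′ = seq b ∘ suc
    b₀ = seq b 0
    aₙ = seq a n
    aₙ₊₁ = seq a (suc n)
    bₙ₊₁ = seq b (suc n)
    bₙ₊₂ = seq b (suc (suc n))
    d = cross (seq a) b′ n
    e = cross (seq a) b′ (suc n)

    lower : seq (a +ᴹ tail b) n ⊙ b₀ ≈ aₙ ⊙ b₀ ⊕ (d ⊕ bₙ₊₁)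
    lower = begin
      seq (a +ᴹ tail b) n ⊙ b₀      ≈⟨ ⊙-cong (trans (+ˢ≈cross (seq a) b′ n) (⊕-assoc _ _ _)) refl ⟩
      (aₙ ⊕ (d ⊕ bₙ₊₁)) ⊙ b₀        ≈⟨ ⊙-comm _ _ ⟩
      -- The head `b₀` absorbs every later entry of `b`, hence also `d`, whose summands lie below
      -- such entries.
      b₀ ⊙ (aₙ ⊕ (d ⊕ bₙ₊₁))        ≈⟨ ⊙-⊕-absorbed aₙ (absorb-⊕
                                         (cross-absorbed (seq a) (head-absorbs (isGood b)) n)
                                         (head-absorbs (isGood b) n)) ⟩
      b₀ ⊙ aₙ ⊕ (d ⊕ bₙ₊₁)          ≈⟨ ⊕-congʳ (⊙-comm _ _) ⟩
      aₙ ⊙ b₀ ⊕ (d ⊕ bₙ₊₁)          ∎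

    below : e ⊕ bₙ₊₂ ≤ seq (a +ᴹ b) (suc (suc n))
    below = ≤-respʳ (sym (+ˢ≈cross (seq a) (seq b) (suc (suc n))))
      (⊕-mono (≤-trans (y≤x⊕y _ e) (y≤x⊕y _ _)) ≤-refl)

  ≈tail+⟦head⟧ : ∀ a → a ≈ᴹ tail a +ᴹ ⟦ head a ⟧
  ≈tail+⟦head⟧ a = begin
    a                                  ≈⟨ +ᴹ-identityˡ a ⟨
    ⟦ 0̄ ⟧ +ᴹ a                         ≈⟨ +ᴹ-peel ⟦ 0̄ ⟧ a ⟩
    (⟦ 0̄ ⟧ +ᴹ tail a) +ᴹ ⟦ head a ⟧    ≈⟨ +ᴹ-congʳ ⟦ head a ⟧ (⟦ 0̄ ⟧ +ᴹ tail a) (tail a) (+ᴹ-identityˡ (tail a)) ⟩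
    tail a +ᴹ ⟦ head a ⟧               ∎
    where open ≈ᴹR

  -- The bound is exposed as an index for inductions that pass from a sequence to its tail.
  VanishesFrom : ℕ → GoodSequence → Set ℓ
  VanishesFrom N a = ∀ i → N ℕ.≤ i → seq a i ≈ 0̄

  tail-vanishes : ∀ {N} a → VanishesFrom (suc N) a → VanishesFrom N (tail a)
  tail-vanishes a z i N≤i = z (suc i) (s≤s N≤i)

  -- By induction on the bound for `b`: `⟦ x ⟧` moves past the tail of `b` by hypothesis and past
  -- its head by `+⟦⟧-exchange`.
  +⟦⟧-slide : ∀ {N} a x b → VanishesFrom N b → (a +ᴹ ⟦ x ⟧) +ᴹ b ≈ᴹ (a +ᴹ b) +ᴹ ⟦ x ⟧
  +⟦⟧-slide {zero} a x b z = begin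
    (a +ᴹ ⟦ x ⟧) +ᴹ b   ≈⟨ +ᴹ-vanishing (a +ᴹ ⟦ x ⟧) b (λ i → z i z≤n) ⟩
    a +ᴹ ⟦ x ⟧          ≈⟨ +ᴹ-congʳ ⟦ x ⟧ (a +ᴹ b) a (+ᴹ-vanishing a b (λ i → z i z≤n)) ⟨
    (a +ᴹ b) +ᴹ ⟦ x ⟧   ∎
    where open ≈ᴹR
  +⟦⟧-slide {suc N} a x b z = begin
    (a +ᴹ ⟦ x ⟧) +ᴹ b          ≈⟨ +ᴹ-peel (a +ᴹ ⟦ x ⟧) b ⟩
    ((a +ᴹ ⟦ x ⟧) +ᴹ b′) +ᴹ h  ≈⟨ +ᴹ-congʳ h ((a +ᴹ ⟦ x ⟧) +ᴹ b′) ((a +ᴹ b′) +ᴹ ⟦ x ⟧)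
                                    (+⟦⟧-slide a x b′ (tail-vanishes b z)) ⟩
    ((a +ᴹ b′) +ᴹ ⟦ x ⟧) +ᴹ h  ≈⟨ +⟦⟧-exchange (a +ᴹ b′) x (head b) ⟩
    ((a +ᴹ b′) +ᴹ h) +ᴹ ⟦ x ⟧  ≈⟨ +ᴹ-congʳ ⟦ x ⟧ (a +ᴹ b) ((a +ᴹ b′) +ᴹ h) (+ᴹ-peel a b) ⟨
    (a +ᴹ b) +ᴹ ⟦ x ⟧          ∎
    where
    open ≈ᴹR
    b′ = tail b
    h  = ⟦ head b ⟧

  -- Up to commutativity this is `+⟦⟧-slide`, with `a` as the sequence that is slid past.
  +⟦⟧-assoc : ∀ a b x → (a +ᴹ b) +ᴹ ⟦ x ⟧ ≈ᴹ a +ᴹ (b +ᴹ ⟦ x ⟧)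
  +⟦⟧-assoc a b x = begin
    (a +ᴹ b) +ᴹ ⟦ x ⟧   ≈⟨ +ᴹ-congʳ ⟦ x ⟧ (a +ᴹ b) (b +ᴹ a) (+ᴹ-comm a b) ⟩
    (b +ᴹ a) +ᴹ ⟦ x ⟧   ≈⟨ +⟦⟧-slide b x a (proj₂ (eventuallyZero a)) ⟨
    (b +ᴹ ⟦ x ⟧) +ᴹ a   ≈⟨ +ᴹ-comm (b +ᴹ ⟦ x ⟧) a ⟩
    a +ᴹ (b +ᴹ ⟦ x ⟧)   ∎
    where open ≈ᴹR

  -- Peeling `c` reduces associativity to its tail, by induction, and to a one-term summand, by
  -- `+⟦⟧-assoc`.
  +ᴹ-assoc-vanishing : ∀ {N} a b c → VanishesFrom N c → (a +ᴹ b) +ᴹ c ≈ᴹ a +ᴹ (b +ᴹ c)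
  +ᴹ-assoc-vanishing {zero} a b c z = begin
    (a +ᴹ b) +ᴹ c   ≈⟨ +ᴹ-vanishing (a +ᴹ b) c (λ i → z i z≤n) ⟩
    a +ᴹ b          ≈⟨ +ᴹ-congˡ a (b +ᴹ c) b (+ᴹ-vanishing b c (λ i → z i z≤n)) ⟨
    a +ᴹ (b +ᴹ c)   ∎
    where open ≈ᴹR
  +ᴹ-assoc-vanishing {suc N} a b c z = begin
    (a +ᴹ b) +ᴹ c            ≈⟨ +ᴹ-peel (a +ᴹ b) c ⟩
    ((a +ᴹ b) +ᴹ c′) +ᴹ h    ≈⟨ +ᴹ-congʳ h ((a +ᴹ b) +ᴹ c′) (a +ᴹ (b +ᴹ c′))
                                  (+ᴹ-assoc-vanishing a b c′ (tail-vanishes c z)) ⟩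
    (a +ᴹ (b +ᴹ c′)) +ᴹ h    ≈⟨ +⟦⟧-assoc a (b +ᴹ c′) (head c) ⟩
    a +ᴹ ((b +ᴹ c′) +ᴹ h)    ≈⟨ +ᴹ-congˡ a (b +ᴹ c) ((b +ᴹ c′) +ᴹ h) (+ᴹ-peel b c) ⟨
    a +ᴹ (b +ᴹ c)            ∎
    where
    open ≈ᴹR
    c′ = tail c
    h  = ⟦ head c ⟧

  +ᴹ-assoc : ∀ a b c → (a +ᴹ b) +ᴹ c ≈ᴹ a +ᴹ (b +ᴹ c)
  +ᴹ-assoc a b c = +ᴹ-assoc-vanishing a b c (proj₂ (eventuallyZero c))

  +ᴹ-isCommutativeMonoid : IsCommutativeMonoid _≈ᴹ_ _+ᴹ_ ⟦ 0̄ ⟧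
  +ᴹ-isCommutativeMonoid = record
    { isMonoid = record
      { isSemigroup = record
        { isMagma = record
          { isEquivalence = ≈ᴹ-isEquivalence
          ; ∙-cong = λ {a} {a′} {b} {b′} → +ᴹ-cong a b a′ b′ }
        ; assoc = +ᴹ-assoc }
      ; identity = +ᴹ-identityˡ , +ᴹ-identityʳ }
    ; comm = +ᴹ-comm }

  +ᴹ-commutativeMonoid : CommutativeMonoid (c ⊔ ℓ) ℓ
  +ᴹ-commutativeMonoid = record { isCommutativeMonoid = +ᴹ-isCommutativeMonoid }

  -- Generation by one-term sequences, the unit, and joins.

  generatedByEntries : ∀ {N} a → VanishesFrom N a → Generated +ᴹ-commutativeMonoid ⟦_⟧ a
  generatedByEntries {zero}  a z = empty (λ i → trans (z i z≤n) (sym (⟦0⟧-vanishes i)))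
  generatedByEntries {suc N} a z =
    extend (head a) (generatedByEntries (tail a) (tail-vanishes a z)) (≈tail+⟦head⟧ a)

  generated : ∀ a → Generated +ᴹ-commutativeMonoid ⟦_⟧ a
  generated a = generatedByEntries a (proj₂ (eventuallyZero a))

  ⟦⟧-complement : ∀ x → ⟦ x ⟧ +ᴹ ⟦ ¬ x ⟧ ≈ᴹ ⟦ 1̄ ⟧
  ⟦⟧-complement x zero = trans (+⟦⟧-zero ⟦ x ⟧ (¬ x)) (trans (⊕-comm _ _) (¬x⊕x≈1 x))
  ⟦⟧-complement x (suc zero) = trans (+⟦⟧-suc ⟦ x ⟧ (¬ x) 0) (trans (⊕-identityˡ _)
    (trans (⊙-comm _ _) (≤-antisym (¬x⊙x≤0 x) (0≤x _))))
  ⟦⟧-complement x (suc (suc n)) = trans (+⟦⟧-suc ⟦ x ⟧ (¬ x) (suc n))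
    (trans (⊕-identityˡ _) (⊙-zeroˡ _))

  +⟦1⟧-zero : ∀ a → seq (a +ᴹ ⟦ 1̄ ⟧) 0 ≈ 1̄
  +⟦1⟧-zero a = trans (+⟦⟧-zero a 1̄) (⊕-zeroʳ _)

  +⟦1⟧-suc : ∀ a n → seq (a +ᴹ ⟦ 1̄ ⟧) (suc n) ≈ seq a n
  +⟦1⟧-suc a n = trans (+⟦⟧-suc a 1̄ n)
    (trans (⊕-congˡ (⊙-identityʳ _)) (trans (⊕-comm _ _) (isGood a n)))

  +⟦1⟧-cancel : ∀ a b → a +ᴹ ⟦ 1̄ ⟧ ≤ᴹ b +ᴹ ⟦ 1̄ ⟧ → a ≤ᴹ b
  +⟦1⟧-cancel a b p n = ≤-respʳ (+⟦1⟧-suc b n)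
    (≤-trans (≤-reflexive (sym (+⟦1⟧-suc a n))) (p (suc n)))

  infixl 5 _∨ᴹ_
  _∨ᴹ_ : Op₂ GoodSequence
  a ∨ᴹ b = record
    { seq            = λ i → seq a i ∨ seq b i
    -- The join at `i` absorbs both next entries because it lies above the entries that do; so it
    -- absorbs their sum, and the next join lies below that sum.
    ; isGood         = λ i → absorb-anti (∨≤⊕ _ _) (absorb-⊕
                         (absorb-mono (x≤x∨y _ _) (isGood a i))
                         (absorb-mono (y≤x∨y _ _) (isGood b i)))
    ; eventuallyZero = let (M , za) = eventuallyZero a
                           (N , zb) = eventuallyZero b in
        M ℕ.+ N , λ i l → ≤-antisym
          (∨-least (≤-reflexive (za i (ℕₚ.m+n≤o⇒m≤o M l))) (≤-reflexive (zb i (ℕₚ.m+n≤o⇒n≤o M l))))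
          (0≤x _) }

  ∨ᴹ-+⟦1⟧ : ∀ a b → (a ∨ᴹ b) +ᴹ ⟦ 1̄ ⟧ ≤ᴹ (a +ᴹ ⟦ 1̄ ⟧) ∨ᴹ (b +ᴹ ⟦ 1̄ ⟧)
  ∨ᴹ-+⟦1⟧ a b zero = ≤-trans
    (≤-reflexive (trans (+⟦1⟧-zero (a ∨ᴹ b)) (sym (+⟦1⟧-zero a)))) (x≤x∨y _ _)
  ∨ᴹ-+⟦1⟧ a b (suc n) = ≤-trans (≤-reflexive (+⟦1⟧-suc (a ∨ᴹ b) n)) (∨-least
    (≤-trans (≤-reflexive (sym (+⟦1⟧-suc a n))) (x≤x∨y _ _))
    (≤-trans (≤-reflexive (sym (+⟦1⟧-suc b n))) (y≤x∨y _ _)))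

  unitOrderedMonoid : UnitOrderedMonoid (c ⊔ ℓ) ℓ
  unitOrderedMonoid = record
    { commutativeMonoid = +ᴹ-commutativeMonoid
    ; _≤_               = _≤ᴹ_
    ; isPartialOrder    = ≤ᴹ-isPartialOrder
    ; ∙-monoˡ           = λ {a} {b} c a≤b → +ᴹ-mono a c b c a≤b (λ _ → ≤-refl)
    ; ε-minimum         = λ a i → ≤-trans (≤-reflexive (⟦0⟧-vanishes i)) (0≤x _)
    ; _⋎_               = _∨ᴹ_
    ; ⋎-supremum        = λ a b → (λ i → x≤x∨y _ _) , (λ i → y≤x∨y _ _) ,
                                  (λ d a≤d b≤d i → ∨-least (a≤d i) (b≤d i))
    ; e                 = ⟦ 1̄ ⟧
    ; e-cancel          = λ {a} {b} → +⟦1⟧-cancel a b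
    ; e-⋎               = ∨ᴹ-+⟦1⟧
    ; complement        = generated⇒complemented +ᴹ-commutativeMonoid ⟦_⟧
                            (λ x → ⟦ ¬ x ⟧ , ⟦⟧-complement x) ∘ generated
    }

-- Halving by means of `κ`.

module Halving {c ℓ} (A : ContinuousAlgebra c ℓ) where
  open ContinuousAlgebra A using (κ; κ-fix; mvAlgebra)
  open MVAlgebra mvAlgebra
  open MVProperties mvAlgebra
  open MVLemmas mvAlgebra
  open GoodSequences mvAlgebra
  open ChangGroup mvAlgebra
  open IsEquivalence isEquivalence using (refl; sym; trans)

  κ⊕κ : ∀ x → κ x ⊕ κ x ≈ 1̄
  κ⊕κ x = begin
    κ x ⊕ κ x             ≈⟨ ⊕-congʳ (κ-fix x) ⟩
    x ⊕ ¬ κ x ⊕ κ x       ≈⟨ ⊕-assoc _ _ _ ⟩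
    x ⊕ (¬ κ x ⊕ κ x)     ≈⟨ ⊕-congˡ (¬x⊕x≈1 (κ x)) ⟩
    x ⊕ 1̄                 ≈⟨ ⊕-zeroʳ x ⟩
    1̄                     ∎
    where open ≈R

  -- By `κ-fix` the product is the meet of `κ x` and `x`, and the same axiom gives `x ≤ κ x`.
  κ⊙κ : ∀ x → κ x ⊙ κ x ≈ x
  κ⊙κ x = begin
    κ x ⊙ κ x             ≈⟨ ⊙-cong refl (trans (κ-fix x) (⊕-comm _ _)) ⟩
    κ x ⊙ (¬ κ x ⊕ x)     ≈⟨ ≥⇒meet (≤-respʳ (sym (κ-fix x)) (x≤x⊕y x _)) ⟩
    x                     ∎
    where open ≈R

  -- Both sides are the sequence `1̄`, `x`, `0̄`, ...; thus `κ x` plays the role of half of `x` plus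
  -- the unit.
  ⟦κ⟧-double : ∀ x → ⟦ κ x ⟧ +ᴹ ⟦ κ x ⟧ ≈ᴹ ⟦ x ⟧ +ᴹ ⟦ 1̄ ⟧
  ⟦κ⟧-double x zero = trans (+⟦⟧-zero ⟦ κ x ⟧ (κ x)) (trans (κ⊕κ x) (sym (+⟦1⟧-zero ⟦ x ⟧)))
  ⟦κ⟧-double x (suc zero) = trans (+⟦⟧-suc ⟦ κ x ⟧ (κ x) 0)
    (trans (⊕-identityˡ _) (trans (κ⊙κ x) (sym (+⟦1⟧-suc ⟦ x ⟧ 0))))
  ⟦κ⟧-double x (suc (suc n)) = trans (+⟦⟧-suc ⟦ κ x ⟧ (κ x) (suc n))
    (trans (⊕-identityˡ _) (trans (⊙-zeroˡ _) (sym (+⟦1⟧-suc ⟦ x ⟧ (suc n)))))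

  ⟦⟧-halves : ∀ x → Halves +ᴹ-commutativeMonoid ⟦ x ⟧
  -- Doubling `⟦ κ x ⟧` exceeds `⟦ x ⟧` by `⟦ 1̄ ⟧`, and `⟦ κ 0̄ ⟧` is half of that excess.
  ⟦⟧-halves x = ⟦ κ x ⟧ , ⟦ κ 0̄ ⟧ , (begin
    ⟦ κ x ⟧ +ᴹ ⟦ κ x ⟧               ≈⟨ ⟦κ⟧-double x ⟩
    ⟦ x ⟧ +ᴹ ⟦ 1̄ ⟧                   ≈⟨ +ᴹ-congˡ ⟦ x ⟧ (⟦ 0̄ ⟧ +ᴹ ⟦ 1̄ ⟧) ⟦ 1̄ ⟧ (+ᴹ-identityˡ ⟦ 1̄ ⟧) ⟨
    ⟦ x ⟧ +ᴹ (⟦ 0̄ ⟧ +ᴹ ⟦ 1̄ ⟧)        ≈⟨ +ᴹ-congˡ ⟦ x ⟧ (⟦ κ 0̄ ⟧ +ᴹ ⟦ κ 0̄ ⟧) (⟦ 0̄ ⟧ +ᴹ ⟦ 1̄ ⟧) (⟦κ⟧-double 0̄) ⟨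
    ⟦ x ⟧ +ᴹ (⟦ κ 0̄ ⟧ +ᴹ ⟦ κ 0̄ ⟧)    ∎)
    where open ≈ᴹR

  halves : ∀ a → Halves +ᴹ-commutativeMonoid a
  halves a = generated⇒halves +ᴹ-commutativeMonoid ⟦_⟧ ⟦⟧-halves (generated a)

mainTheorem5 : ∀ {c ℓ} (A : ContinuousAlgebra c ℓ) →
    let open ChangGroup (ContinuousAlgebra.mvAlgebra A) in
    Σ[ _∨_ ∈ Op₂ G ] Σ[ _∧_ ∈ Op₂ G ]
    ( IsℓuGroup _∼_ _+_ -_ id _∨_ _∧_ u
    × (∀ x y → (x ⪯ y) ⇔ ((x ∧ y) ∼ x))
    × TwoDivisible _∼_ _+_ )
-- Over the monoid of good sequences, the operations, relations and unit of `DifferenceGroup` unfold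
-- to those of `ChangGroup`.
mainTheorem5 A = _∨_ , _∧_ , isℓuGroup , ⪯⇔∧ , halves⇒twoDivisible (Halving.halves A)
  where open DifferenceGroup (GoodSequences.unitOrderedMonoid (ContinuousAlgebra.mvAlgebra A))
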